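{- Let $(G,T)$ be a bipartite graft with color classes $A$ and $B$, let $F$ be a minimum join, and let $X\subseteq A$ be a maximal bipartitic extreme set. Then $X$ is $F$-combic and: (i) the set of connected components of $G[D_X]$ equals $\mathrm{Odd}_T(G-X)$; (ii) for every $C\in\mathrm{Odd}_T(G-X)$ and the vertex $r_C\in V(C)$ that is the end of the unique edge of $\delta_G(V(C))\cap F$, the graft $(C,(T\cap V(C))\,\Delta\,\{r_C\})$ is primal with respect to $r_C$, and $N_G(X)\cap V(C)\subseteq A_{(C,(T\cap V(C))\Delta\{r_C\})}(r_C)$; (iii) every member of $\mathrm{Even}_T(G-X)$ is a trivial factor-component of $(G,T)$ (i.e. consists of a single trivial vertex).
   Context: All graphs are finite (parallel edges allowed). A graft is a pair $(G,T)$ with $T\subseteq V(G)$; a join is $F\subseteq E(G)$ such that each vertex is incident to an odd number of edges of $F$ iff it lies in $T$; a minimum join is one of minimum size. A bipartite graft has $G$ bipartite with given color classes. For $F\subseteq E$ and a subgraph $Q$, $w_F(Q)=|E(Q)\setminus F|-|E(Q)\cap F|$; $\lambda_{(G,T),F}(x,y)$ is the minimum of $w_F(P)$ over paths $P$ between $x$ and $y$ ($0$ if $x=y$); for a minimum join $F$ it does not depend on the choice of $F$. $\delta_G(Y)$: edges with exactly one end in $Y$; $E_G[Y]$: edges with both ends in $Y$; $N_G(Y)$: vertices outside $Y$ adjacent to a vertex of $Y$. $\mathrm{Odd}_T(H)$ / $\mathrm{Even}_T(H)$: connected components $C$ of $H$ with $|V(C)\cap T|$ odd / even. $X$ is $F$-combic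 if $E_G[X]\cap F=\emptyset$, $|\delta_G(V(C))\cap F|=1$ for every $C\in\mathrm{Odd}_T(G-X)$, and $\delta_G(V(C))\cap F=\emptyset$ for every $C\in\mathrm{Even}_T(G-X)$. Extreme: $\lambda_{(G,T),F}(x,y)\ge0$ for all $x,y\in X$; bipartitic: also contained in a color class; maximal bipartitic extreme: not properly contained in another bipartitic extreme set. $D_X:=\{y\notin X:\min_{x\in X}\lambda_{(G,T),F}(x,y)<0\}$. A graft $(H,S)$ is primal with respect to $r\in V(H)$ if $\lambda_{(H,S),F'}(r,x)\le0$ for every $x\in V(H)$, $F'$ a minimum join; for a graft primal with respect to $r$, $A_{(H,S)}(r):=\{x\in V(H):\lambda_{(H,S),F'}(r,x)=0\}$. An edge is allowed if it lies in some minimum join; factor-components are the connected components of the spanning subgraph of allowed edges; a factor-component is trivial if it has one vertex, which is then called trivial. -}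

module Defs where

open import Data.Nat using (ℕ; zero; suc; _+_; _%_; _≤_)
open import Data.Integer as ℤ using (ℤ; +_; -[1+_])
open import Data.Fin using (Fin; zero; suc; _≟_)
open import Data.Bool using (Bool; true; false; if_then_else_; _∧_; not; _xor_)
open import Data.Product using (Σ; ∃; _×_; _,_)
open import Data.Sum using (_⊎_)
open import Data.Unit using (⊤)
open import Data.List using (List; []; _∷_)
open import Data.List.Relation.Unary.Unique.Propositional using (Unique)
open import Relation.Binary.PropositionalEquality using (_≡_; _≢_)
open import Relation.Nullary using (¬_)
open import Relation.Nullary.Decidable using (⌊_⌋)

_⟺_ : Set → Set → Set
P ⟺ Q = (P → Q) × (Q → P)
infix 2 _⟺_

Sub : ℕ → Set
Sub n = Fin n → Bool

_∈_ : ∀ {n} → Fin n → Sub n → Set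
x ∈ S = S x ≡ true

_∉_ : ∀ {n} → Fin n → Sub n → Set
x ∉ S = ¬ (x ∈ S)

infix 4 _∈_ _∉_

_⊆_ : ∀ {n} → Sub n → Sub n → Set
S ⊆ S' = ∀ x → x ∈ S → x ∈ S'

_⊂_ : ∀ {n} → Sub n → Sub n → Set
S ⊂ S' = S ⊆ S' × ∃ λ x → x ∈ S' × x ∉ S

full : ∀ {n} → Sub n
full _ = true

compl : ∀ {n} → Sub n → Sub n
compl S x = not (S x)

_∩_ : ∀ {n} → Sub n → Sub n → Sub n
(S ∩ S') x = S x ∧ S' x

card : ∀ {n} → Sub n → ℕ
card {zero}  S = 0
card {suc n} S = (if S zero then 1 else 0) + card (λ i → S (suc i))

Odd : ℕ → Set
Odd k = k % 2 ≡ 1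

Even : ℕ → Set
Even k = k % 2 ≡ 0

record Graph : Set where
  field
    nV   : ℕ
    nE   : ℕ
    end₁ : Fin nE → Fin nV
    end₂ : Fin nE → Fin nV
open Graph public

module _ (G : Graph) where

  V = Fin (nV G)
  E = Fin (nE G)

  Joins : E → V → V → Set
  Joins e x z = (end₁ G e ≡ x × end₂ G e ≡ z) ⊎ (end₂ G e ≡ x × end₁ G e ≡ z)

  InE : Sub (nV G) → E → Set
  InE U e = end₁ G e ∈ U × end₂ G e ∈ U

  crosses : Sub (nV G) → E → Bool
  crosses Y e = Y (end₁ G e) xor Y (end₂ G e)

  -- number of edges of F incident with v (a loop counted twice)
  degIn : Sub (nE G) → V → ℕ
  degIn F v = card (λ e → F e ∧ ⌊ end₁ G e ≟ v ⌋) + card (λ e → F e ∧ ⌊ end₂ G e ≟ v ⌋)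

  IsBipartition : Sub (nV G) → Set
  IsBipartition A = ∀ e → (A (end₁ G e) xor A (end₂ G e)) ≡ true

  -- Joins of the graft (G[U], S)  (U = full gives the graft (G,S) itself)

  IsJoin : Sub (nV G) → Sub (nV G) → Sub (nE G) → Set
  IsJoin U S F = (∀ e → e ∈ F → InE U e) × (∀ v → v ∈ U → (Odd (degIn F v) ⟺ v ∈ S))

  IsMinJoin : Sub (nV G) → Sub (nV G) → Sub (nE G) → Set
  IsMinJoin U S F = IsJoin U S F × (∀ F' → IsJoin U S F' → card F ≤ card F')

  data Walk (U : Sub (nV G)) (P : E → Set) : V → V → Set where
    nil  : ∀ {x} → x ∈ U → Walk U P x x
    cons : ∀ {x z y} (e : E) → P e → Joins e x z → x ∈ U → Walk U P z y → Walk U P x y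

  verts : ∀ {U P x y} → Walk U P x y → List V
  verts (nil {x} _)           = x ∷ []
  verts (cons {x} _ _ _ _ w)  = x ∷ verts w

  IsPath : ∀ {U P x y} → Walk U P x y → Set
  IsPath w = Unique (verts w)

  AllE : E → Set
  AllE _ = ⊤

  weight : ∀ {U P x y} → Sub (nE G) → Walk U P x y → ℤ
  weight F (nil _)            = + 0
  weight F (cons e _ _ _ w)   = (if F e then -[1+ 0 ] else + 1) ℤ.+ weight F w

  IsLambda : Sub (nV G) → Sub (nE G) → V → V → ℤ → Set
  IsLambda U F x y k =
    (Σ (Walk U AllE x y) λ p → IsPath p × weight F p ≡ k) ×
    (∀ (p : Walk U AllE x y) → IsPath p → k ℤ.≤ weight F p)

  Reach : Sub (nV G) → (E → Set) → V → V → Set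
  Reach U P x y = Walk U P x y

  IsComponentP : Sub (nV G) → (E → Set) → Sub (nV G) → Set
  IsComponentP U P C = ∃ λ x → x ∈ U × (∀ y → (y ∈ C ⟺ Reach U P x y))

  IsComponent : Sub (nV G) → Sub (nV G) → Set
  IsComponent U C = IsComponentP U AllE C

  IsOddComp : Sub (nV G) → Sub (nV G) → Sub (nV G) → Set
  IsOddComp T U C = IsComponent U C × Odd (card (T ∩ C))

  IsEvenComp : Sub (nV G) → Sub (nV G) → Sub (nV G) → Set
  IsEvenComp T U C = IsComponent U C × Even (card (T ∩ C))

  FCombic : Sub (nV G) → Sub (nE G) → Sub (nV G) → Set
  FCombic T F X =
    (∀ e → e ∈ F → ¬ InE X e) ×
    (∀ C → IsOddComp T (compl X) C → card (λ e → F e ∧ crosses C e) ≡ 1) ×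
    (∀ C → IsEvenComp T (compl X) C → card (λ e → F e ∧ crosses C e) ≡ 0)

  Extreme : Sub (nE G) → Sub (nV G) → Set
  Extreme F X = ∀ x y → x ∈ X → y ∈ X → ∀ k → IsLambda full F x y k → + 0 ℤ.≤ k

  Bipartitic : Sub (nV G) → Sub (nV G) → Set
  Bipartitic A X = X ⊆ A ⊎ X ⊆ compl A

  BipExtreme : Sub (nV G) → Sub (nE G) → Sub (nV G) → Set
  BipExtreme A F X = Bipartitic A X × Extreme F X

  MaximalBipExtreme : Sub (nV G) → Sub (nE G) → Sub (nV G) → Set
  MaximalBipExtreme A F X = BipExtreme A F X × (∀ Y → BipExtreme A F Y → ¬ (X ⊂ Y))

  InDX : Sub (nE G) → Sub (nV G) → V → Set
  InDX F X y = y ∉ X × ∃ λ x → x ∈ X × ∃ λ k → IsLambda full F x y k × k ℤ.< + 0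

  InN : Sub (nV G) → V → Set
  InN X y = y ∉ X × ∃ λ e → ∃ λ u → Joins e u y × u ∈ X

  Primal : Sub (nV G) → Sub (nV G) → V → Set
  Primal U S r = ∀ F' → IsMinJoin U S F' → ∀ x → x ∈ U → ∃ λ k → IsLambda U F' r x k × k ℤ.≤ + 0

  InA : Sub (nV G) → Sub (nV G) → V → V → Set
  InA U S r x = x ∈ U × (∀ F' → IsMinJoin U S F' → IsLambda U F' r x (+ 0))

  Allowed : Sub (nV G) → E → Set
  Allowed T e = ∃ λ F → IsMinJoin full T F × e ∈ F

  IsFactorComponent : Sub (nV G) → Sub (nV G) → Set
  IsFactorComponent T K = IsComponentP full (Allowed T) K

  symdiffPt : Sub (nV G) → Sub (nV G) → V → Sub (nV G)
  symdiffPt T C r v = C v ∧ (T v xor ⌊ v ≟ r ⌋)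

{-# OPTIONS --safe #-}

-- Write ∂J for the set of vertices of odd degree in J.  As F is a minimum join, the F-weight of J is
-- |F △ J| − |F|, and λ(x , y) is its minimum over all J with ∂J = {x , y}.  By maximality every vertex
-- of A \ X lies in D_X, so a vertex outside X ∪ D_X is isolated in G − X and has no allowed edge.
--
-- Let C be a component of G[D_X] and contract everything outside C to one vertex r₀; X being extreme,
-- F ∩ (E[C] ∪ δ(C)) stays a minimum join.  Let q(y) be the minimum size of a (T △ {r₀ , y})-join in the
-- contracted graph; then q(y) < q(r₀) for all y in C, and q changes by exactly 1 along each edge.  The
-- key statement (cut-at-root, in the spirit of Sebő's distance theorem) is that a minimum join for
-- y = r₀ has exactly one edge at r₀, and one for y ≠ r₀ has none.  It is shown by induction on the
-- number of vertices at a vertex v minimising q: two neighbours of v can be identified without changing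
-- q, and a v with a single neighbour can be contracted into it, which lowers q by 1.
--
-- The first half gives |δ(C) ∩ F| = 1; the second gives, for each y in C, joins inside C whose
-- size bounds λ(r_C , y) from above by 0.
module Submission where

open import Defs
open import Algebra.Bundles using (CommutativeRing)
import Algebra.Properties.Semiring.Sum as SemiringSum
open import Data.Bool using (Bool; true; false; if_then_else_; _∧_; _∨_; not; _xor_)
open import Data.Bool.Properties
  using (xor-∧-commutativeRing; xor-same; xor-comm; xor-assoc; xor-identityʳ; xor-annihilates-not; not-injective;
         ∨-identityʳ; ∨-zeroʳ; ∧-zeroʳ; ∧-identityʳ; ∧-comm; ∧-distribʳ-xor; ∧-distribˡ-xor)
  renaming (_≟_ to _≟ᵇ_)
open import Data.Bool.Solver using (module xor-∧-Solver)
open import Data.Empty using (⊥)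
open import Data.Fin using (Fin; zero; suc; _≟_)
open import Data.Fin.Properties using (any?; all?)
open import Data.Fin.Subset.Properties using (anySubset?)
open import Data.Integer as ℤ using (+_; -[1+_]; _⊖_)
import Data.Integer.Properties as ℤₚ
open import Data.List using ([]; _∷_)
import Data.List.Membership.DecPropositional as DecList
import Data.List.Membership.Propositional as List
open import Data.List.Relation.Unary.All using ([]; _∷_)
open import Data.List.Relation.Unary.All.Properties using (¬Any⇒All¬; All¬⇒¬Any)
open import Data.List.Relation.Unary.AllPairs using ([]; _∷_)
open import Data.List.Relation.Unary.Any using (here; there)
open import Data.List.Relation.Unary.Unique.Propositional using (Unique)
open import Data.Nat using (ℕ; zero; suc; _+_; _∸_; _%_; _≤_; _<_; z≤n; _<?_)
open import Data.Nat.DivMod using (%-distribˡ-+)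
open import Data.Nat.Induction using (<-wellFounded)
open import Data.Nat.Properties hiding (_≟_)
open import Data.Product using (Σ; ∃; _×_; _,_; proj₁; proj₂)
open import Data.Sum using (_⊎_; inj₁; inj₂; [_,_]′)
open import Data.Unit using (tt)
open import Data.Vec using (lookup; tabulate)
open import Data.Vec.Properties using (lookup∘tabulate)
open import Function using (_∘_)
open import Induction.WellFounded using (Acc; acc)
open import Relation.Binary.PropositionalEquality
  using (_≡_; _≢_; _≗_; refl; sym; trans; cong; cong₂; subst; subst₂; module ≡-Reasoning)
open import Relation.Nullary using (¬_; Dec; yes; no; contradiction)
open import Relation.Nullary.Decidable using (⌊_⌋; map′; _×-dec_; _→-dec_)

open xor-∧-Solver using (solve; _:+_; _:*_; _:=_; con)
open SemiringSum (CommutativeRing.semiring xor-∧-commutativeRing)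
  using (∑-distrib-+; ∑-comm; *-distribˡ-sum) renaming (sum to ⨁; sum-cong-≗ to ⨁-cong)

-- Everything is computed with edge sets modulo 2 instead of paths. A contraction only relabels the
-- ends of edges, so one `J` serves every graph of the induction, whereas paths would have to be
-- lifted; `shortest` translates back to paths and to λ. `Levelled` keeps what survives a
-- contraction: q is a true minimum, r lies strictly above all other vertices, levels differ along
-- edges, and G - r is connected. Bipartiteness enters the induction through the parity of q;
-- connectivity settles the case of v adjacent to r, where no third vertex can be left. The obstacle
-- is that merging a and b admits new edge sets, whose boundary is wrong by {a , b} before the
-- merge. They must be shown not to beat q, and an exchange with a minimum join for v does this. Odd
-- and even components are told apart by parity: membership in D_X is constant on a component of G -
-- X, and F leaves the component once or never accordingly.

private variable
  n : ℕ

-- Subsets as Boolean vectors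

∅ : Sub n
∅ _ = false

infixl 6 _△_
_△_ : Sub n → Sub n → Sub n
(S △ S') i = S i xor S' i

pt : Fin n → Sub n
pt a v = ⌊ a ≟ v ⌋

_∖_ : Sub n → Sub n → Sub n
(S ∖ S') i = S i ∧ not (S' i)

pt-refl : (a : Fin n) → pt a a ≡ true
pt-refl a with a ≟ a
... | yes _ = refl
... | no ¬p = contradiction refl ¬p

pt-≡ : {a v : Fin n} → pt a v ≡ true → a ≡ v
pt-≡ {a = a} {v} h with a ≟ v
... | yes p = p

pt-≢ : {a v : Fin n} → a ≢ v → pt a v ≡ false
pt-≢ {a = a} {v} a≢v with a ≟ v
... | yes p = contradiction p a≢v
... | no _  = refl

pt-sym : (a v : Fin n) → pt a v ≡ pt v a
pt-sym a v with a ≟ v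
... | yes refl = sym (pt-refl a)
... | no a≢v   = sym (pt-≢ (a≢v ∘ sym))

bool-cases : (b : Bool) → b ≡ true ⊎ b ≡ false
bool-cases true  = inj₁ refl
bool-cases false = inj₂ refl

true≢false : {b : Bool} → b ≡ true → b ≡ false → ⊥
true≢false refl ()

∧-true : {a b : Bool} → a ∧ b ≡ true → a ≡ true × b ≡ true
∧-true {true} {true} _ = refl , refl

∧-intro : {a b : Bool} → a ≡ true → b ≡ true → a ∧ b ≡ true
∧-intro refl refl = refl

xor-≡ : {a b : Bool} → a xor b ≡ false → a ≡ b
xor-≡ {false} {false} _ = refl
xor-≡ {true}  {true}  _ = refl

⟺→≡ : {a b : Bool} → (a ≡ true ⟺ b ≡ true) → a ≡ b
⟺→≡ {false} {false} _       = refl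
⟺→≡ {false} {true}  (_ , g) = g refl
⟺→≡ {true}  {false} (f , _) = sym (f refl)
⟺→≡ {true}  {true}  _       = refl

-- Sums modulo 2 and cardinalities

⨁-∅ : {f : Fin n → Bool} → (∀ i → f i ≡ false) → ⨁ f ≡ false
⨁-∅ {zero}  h = refl
⨁-∅ {suc n} {f} h = trans (cong (_xor ⨁ (f ∘ suc)) (h zero)) (⨁-∅ (h ∘ suc))

⨁-pt : (i : Fin n) (f : Fin n → Bool) → ⨁ (λ j → pt i j ∧ f j) ≡ f i
⨁-pt {suc n} zero f =
  trans (cong (f zero xor_) (⨁-∅ {n} (λ _ → refl))) (xor-identityʳ (f zero))
⨁-pt {suc n} (suc i) f =
  trans (⨁-cong (λ j → cong (_∧ f (suc j)) (pt-suc i j))) (⨁-pt i (f ∘ suc))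
  where
  pt-suc : (i j : Fin n) → pt (suc i) (suc j) ≡ pt i j
  pt-suc i j with i ≟ j
  ... | yes _ = refl
  ... | no _  = refl

⨁-∃ : {f : Fin n → Bool} → ⨁ f ≡ true → ∃ λ i → f i ≡ true
⨁-∃ {suc n} {f} h with bool-cases (f zero)
... | inj₁ p = zero , p
... | inj₂ p with ⨁-∃ {f = f ∘ suc} (trans (sym (cong (_xor ⨁ (f ∘ suc)) p)) h)
...   | i , q = suc i , q

⟦_⟧ : Bool → ℕ
⟦ b ⟧ = if b then 1 else 0

-- Exchange arguments compare the sizes of two edge sets with those of two others; such a comparison
-- may be checked one element at a time.
card-+-≤ : (f g h k : Sub n) → (∀ i → ⟦ f i ⟧ + ⟦ g i ⟧ ≤ ⟦ h i ⟧ + ⟦ k i ⟧) →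
  card f + card g ≤ card h + card k
card-+-≤ {zero}  f g h k _  = z≤n
card-+-≤ {suc n} f g h k le = begin
  (⟦ f zero ⟧ + card (f ∘ suc)) + (⟦ g zero ⟧ + card (g ∘ suc)) ≡⟨ +-interchange ⟦ f zero ⟧ _ _ _ ⟩
  (⟦ f zero ⟧ + ⟦ g zero ⟧) + (card (f ∘ suc) + card (g ∘ suc)) ≤⟨ +-mono-≤ (le zero) (card-+-≤ _ _ _ _ (le ∘ suc)) ⟩
  (⟦ h zero ⟧ + ⟦ k zero ⟧) + (card (h ∘ suc) + card (k ∘ suc)) ≡⟨ +-interchange ⟦ h zero ⟧ _ _ _ ⟩
  (⟦ h zero ⟧ + card (h ∘ suc)) + (⟦ k zero ⟧ + card (k ∘ suc)) ∎
  where
  open ≤-Reasoning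
  +-interchange : ∀ a b c d → (a + b) + (c + d) ≡ (a + c) + (b + d)
  +-interchange a b c d = trans (+-assoc a b (c + d))
    (trans (cong (_+_ a) (trans (sym (+-assoc b c d)) (trans (cong (_+ d) (+-comm b c)) (+-assoc c b d))))
      (sym (+-assoc a c (b + d))))

card-∅ : card {n} ∅ ≡ 0
card-∅ {zero}  = refl
card-∅ {suc n} = card-∅ {n}

card-mono : {S S' : Sub n} → (∀ i → S i ≡ true → S' i ≡ true) → card S ≤ card S'
card-mono {n} {S} {S'} h = subst₂ _≤_ (+0 S) (+0 S') (card-+-≤ S ∅ S' ∅ (λ i → +-monoˡ-≤ 0 (le (h i))))
  where
  +0 : (R : Sub n) → card R + card {n} ∅ ≡ card R
  +0 R = trans (cong (_+_ (card R)) (card-∅ {n})) (+-identityʳ _)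
  le : {a b : Bool} → (a ≡ true → b ≡ true) → ⟦ a ⟧ ≤ ⟦ b ⟧
  le {false} _ = z≤n
  le {true} {b} h rewrite h refl = ≤-refl

card-cong : {S S' : Sub n} → S ≗ S' → card S ≡ card S'
card-cong h = ≤-antisym (card-mono λ i → trans (sym (h i))) (card-mono λ i → trans (h i))

card-pt : (i : Fin n) → card (pt i) ≡ 1
card-pt {suc n} zero    = cong suc (card-∅ {n})
card-pt {suc n} (suc i) = trans (card-cong pt-suc) (card-pt i)
  where
  pt-suc : pt (suc i) ∘ suc ≗ pt i
  pt-suc j with i ≟ j
  ... | yes _ = refl
  ... | no _  = refl

card-△-pt-≤ : (S : Sub n) (i : Fin n) → card (S △ pt i) ≤ card S + 1
card-△-pt-≤ {n} S i = begin
  card (S △ pt i)                 ≤⟨ m≤m+n _ _ ⟩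
  card (S △ pt i) + card {n} ∅    ≤⟨ card-+-≤ _ _ _ _ (λ j → le (S j) (pt i j)) ⟩
  card S + card (pt i)            ≡⟨ cong (_+_ (card S)) (card-pt i) ⟩
  card S + 1                      ∎
  where
  open ≤-Reasoning
  le : ∀ a b → ⟦ a xor b ⟧ + 0 ≤ ⟦ a ⟧ + ⟦ b ⟧
  le false false = ≤-refl
  le false true  = ≤-refl
  le true  false = ≤-refl
  le true  true  = z≤n

card-△-pt-∈ : (S : Sub n) {i : Fin n} → i ∈ S → card (S △ pt i) + 1 ≡ card S
card-△-pt-∈ {n} S {i} i∈S = ≤-antisym
  (begin
    card (S △ pt i) + 1           ≡⟨ cong (_+_ (card (S △ pt i))) (card-pt i) ⟨
    card (S △ pt i) + card (pt i) ≤⟨ card-+-≤ _ _ _ _ le ⟩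
    card S + card {n} ∅           ≡⟨ cong (_+_ (card S)) (card-∅ {n}) ⟩
    card S + 0                    ≡⟨ +-identityʳ _ ⟩
    card S                        ∎)
  (begin
    card S                      ≡⟨ card-cong (λ j → sym (cancel (S j) (pt i j))) ⟩
    card ((S △ pt i) △ pt i)    ≤⟨ card-△-pt-≤ (S △ pt i) i ⟩
    card (S △ pt i) + 1         ∎)
  where
  open ≤-Reasoning
  cancel : ∀ a b → (a xor b) xor b ≡ a
  cancel = solve 2 (λ a b → (a :+ b) :+ b := a) refl
  le : ∀ j → ⟦ (S △ pt i) j ⟧ + ⟦ pt i j ⟧ ≤ ⟦ S j ⟧ + 0
  le j with i ≟ j
  ... | yes refl rewrite i∈S = ≤-refl
  ... | no _ rewrite xor-identityʳ (S j) = ≤-refl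

card-∈ : {S : Sub n} {i : Fin n} → i ∈ S → 1 ≤ card S
card-∈ {S = S} {i} i∈S = ≤-trans (≤-reflexive (sym (card-pt i)))
  (card-mono {S = pt i} {S} λ j p → subst (_∈ S) (pt-≡ {a = i} {j} p) i∈S)

card-split : (S P : Sub n) → card S ≡ card (S ∩ P) + card (S ∖ P)
card-split {zero}  S P = refl
card-split {suc n} S P with S zero | P zero | card-split (S ∘ suc) (P ∘ suc)
... | false | _     | h = h
... | true  | true  | h = cong suc h
... | true  | false | h = trans (cong suc h) (sym (+-suc _ _))

suc-%2 : ∀ k → (k % 2 ≡ 0 × suc k % 2 ≡ 1) ⊎ (k % 2 ≡ 1 × suc k % 2 ≡ 0)
suc-%2 zero          = inj₁ (refl , refl)
suc-%2 (suc zero)    = inj₂ (refl , refl)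
suc-%2 (suc (suc k)) = suc-%2 k

%2-suc : (k : ℕ) (b : Bool) → k % 2 ≡ ⟦ b ⟧ → suc k % 2 ≡ ⟦ not b ⟧
%2-suc k b h with suc-%2 k
%2-suc k false h | inj₁ (p , q) = q
%2-suc k true  h | inj₁ (p , q) = contradiction (trans (sym p) h) λ ()
%2-suc k false h | inj₂ (p , q) = contradiction (trans (sym p) h) λ ()
%2-suc k true  h | inj₂ (p , q) = q

card-%2 : (S : Sub n) → card S % 2 ≡ ⟦ ⨁ S ⟧
card-%2 {zero}  S = refl
card-%2 {suc n} S with S zero
... | false = card-%2 (S ∘ suc)
... | true  = %2-suc (card (S ∘ suc)) (⨁ (S ∘ suc)) (card-%2 (S ∘ suc))

-- The search ranges over vectors; the first argument carries its result to functions, which may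
-- agree pointwise without being equal.
∃Sub? : {P : Sub n → Set} → (∀ {S S'} → S ≗ S' → P S → P S') → (∀ S → Dec (P S)) → Dec (∃ P)
∃Sub? resp P? = map′
  (λ { (v , p) → lookup v , p })
  (λ { (S , p) → tabulate S , resp (λ i → sym (lookup∘tabulate S i)) p })
  (anySubset? (P? ∘ lookup))

least : {P : Sub n → Set} → (∀ {S S'} → S ≗ S' → P S → P S') → (∀ S → Dec (P S)) →
  ∃ P → ∃ λ S → P S × (∀ S' → P S' → card S ≤ card S')
least {n} {P} resp P? (S , p) = go S p (<-wellFounded (card S))
  where
  go : ∀ S → P S → Acc _<_ (card S) → ∃ λ S → P S × (∀ S' → P S' → card S ≤ card S')
  go S p (acc rs) with ∃Sub? {P = λ S' → P S' × card S' < card S}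
    (λ { e (p , l) → resp e p , subst (_< card S) (card-cong e) l })
    (λ S' → P? S' ×-dec (card S' <? card S))
  ... | yes (S' , p' , l) = go S' p' (rs l)
  ... | no ¬smaller = S , p , λ S' p' → ≮⇒≥ λ l → ¬smaller (S' , p' , l)

△-cancelˡ : (S S' : Sub n) → S △ (S △ S') ≗ S'
△-cancelˡ S S' i = solve 2 (λ a b → a :+ (a :+ b) := b) refl (S i) (S' i)

△-cancelʳ : (S S' : Sub n) → (S △ S') △ S' ≗ S
△-cancelʳ S S' i = solve 2 (λ a b → (a :+ b) :+ b := a) refl (S i) (S' i)

△-congˡ : (S : Sub n) {S' S'' : Sub n} → S' ≗ S'' → S △ S' ≗ S △ S''
△-congˡ S h i = cong (S i xor_) (h i)

-- With w(S) = |F △ S| - |F| this reads w(K) + w(J △ K) ≤ w(J): the F-weight is additive over the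
-- disjoint parts `K` and `J △ K` of `J`.
card-△-split : (F : Sub n) {J K : Sub n} → K ⊆ J →
  card (F △ K) + card (F △ (J △ K)) ≤ card F + card (F △ J)
card-△-split F {J} {K} K⊆J = card-+-≤ _ _ _ _ (λ i → le (F i) (J i) (K i) (K⊆J i))
  where
  le : ∀ f j k → (k ≡ true → j ≡ true) → ⟦ f xor k ⟧ + ⟦ f xor (j xor k) ⟧ ≤ ⟦ f ⟧ + ⟦ f xor j ⟧
  le false false false _ = ≤-refl
  le false true  false _ = ≤-refl
  le false true  true  _ = ≤-refl
  le true  false false _ = ≤-refl
  le true  true  false _ = ≤-refl
  le true  true  true  _ = ≤-refl
  le _     false true  h = contradiction (h refl) λ ()

-- Boundaries of edge sets and paths

module _ (G : Graph) where

  -- A loop cancels against itself, so `v ∈ inc e` holds for non-loops only and contractions may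
  -- leave loops behind.
  inc : E G → Sub (nV G)
  inc e v = pt (end₁ G e) v xor pt (end₂ G e) v

  ∂ : Sub (nE G) → Sub (nV G)
  ∂ J v = ⨁ λ e → J e ∧ inc e v

  ∂-△ : ∀ J K v → ∂ (J △ K) v ≡ ∂ J v xor ∂ K v
  ∂-△ J K v = trans (⨁-cong λ e → ∧-distribʳ-xor (inc e v) (J e) (K e))
    (∑-distrib-+ (λ e → J e ∧ inc e v) (λ e → K e ∧ inc e v))

  ∂-pt : ∀ e v → ∂ (pt e) v ≡ inc e v
  ∂-pt e v = ⨁-pt e λ e' → inc e' v

  ∂-△-pt : ∀ J e v → ∂ (J △ pt e) v ≡ ∂ J v xor inc e v
  ∂-△-pt J e v = trans (∂-△ J (pt e) v) (cong (∂ J v xor_) (∂-pt e v))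

  ∂-agree : ∀ {J K} v → (∀ e → inc e v ≡ true → J e ≡ K e) → ∂ J v ≡ ∂ K v
  ∂-agree {J} {K} v h = ⨁-cong eq
    where
    eq : ∀ e → J e ∧ inc e v ≡ K e ∧ inc e v
    eq e with inc e v | h e
    ... | true  | q = cong (_∧ true) (q refl)
    ... | false | _ = trans (∧-zeroʳ (J e)) (sym (∧-zeroʳ (K e)))

  ∂-cong : ∀ {J K} → J ≗ K → ∂ J ≗ ∂ K
  ∂-cong h v = ∂-agree v λ e _ → h e

  ∂-∅ : ∂ ∅ ≗ ∅
  ∂-∅ v = ⨁-∅ {nE G} λ _ → refl

  ∂-edge : ∀ {J v} → ∂ J v ≡ true → ∃ λ e → e ∈ J × v ∈ inc e
  ∂-edge h with e , p ← ⨁-∃ h = e , ∧-true p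

  ∂-isolated : ∀ {J v} → (∀ e → e ∈ J → inc e v ≡ false) → ∂ J v ≡ false
  ∂-isolated {J} {v} h with bool-cases (∂ J v)
  ... | inj₂ q = q
  ... | inj₁ q with e , e∈J , p ← ∂-edge q = contradiction (h e e∈J) λ r → true≢false p r

  inc-Joins : ∀ {e x z} → Joins G e x z → inc e ≗ pt x △ pt z
  inc-Joins (inj₁ (refl , refl)) v = refl
  inc-Joins {e} (inj₂ (refl , refl)) v = xor-comm (pt (end₁ G e) v) _

  Joins-sym : ∀ {e x z} → Joins G e x z → Joins G e z x
  Joins-sym (inj₁ (p , q)) = inj₂ (q , p)
  Joins-sym (inj₂ (p , q)) = inj₁ (q , p)

  inc-other : ∀ {e v} → v ∈ inc e → ∃ λ z → Joins G e v z × z ≢ v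
  inc-other {e} {v} h with end₁ G e ≟ v | end₂ G e ≟ v
  ... | yes p | no ¬q = end₂ G e , inj₁ (p , refl) , ¬q
  ... | no ¬p | yes q = end₁ G e , inj₂ (q , refl) , ¬p

  Joins-inc : ∀ {e x z} → Joins G e x z → x ≢ z → x ∈ inc e
  Joins-inc {e} {x} {z} j x≢z = trans (inc-Joins j x)
    (cong₂ _xor_ (pt-refl x) (pt-≢ (x≢z ∘ sym)))

  -- Double counting of the pairs (v , e) with v ∈ K an end of e ∈ J.
  ⨁-∂ : ∀ K J → ⨁ (λ v → K v ∧ ∂ J v) ≡ ⨁ (λ e → J e ∧ crosses G K e)
  ⨁-∂ K J = begin
    ⨁ (λ v → K v ∧ ⨁ (λ e → J e ∧ inc e v))     ≡⟨ ⨁-cong (λ v → *-distribˡ-sum (K v) λ e → J e ∧ inc e v) ⟩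
    ⨁ (λ v → ⨁ (λ e → K v ∧ (J e ∧ inc e v)))   ≡⟨ ∑-comm (λ v e → K v ∧ (J e ∧ inc e v)) ⟩
    ⨁ (λ e → ⨁ (λ v → K v ∧ (J e ∧ inc e v)))   ≡⟨ ⨁-cong inner ⟩
    ⨁ (λ e → J e ∧ crosses G K e)               ∎
    where
    open ≡-Reasoning
    inner : ∀ e → ⨁ (λ v → K v ∧ (J e ∧ inc e v)) ≡ J e ∧ crosses G K e
    inner e = begin
      ⨁ (λ v → K v ∧ (J e ∧ inc e v))
        ≡⟨ ⨁-cong (λ v → solve 4 (λ k j a b → k :* (j :* (a :+ b)) := j :* (a :* k :+ b :* k)) refl
             (K v) (J e) (pt (end₁ G e) v) (pt (end₂ G e) v)) ⟩
      ⨁ (λ v → J e ∧ ((pt (end₁ G e) v ∧ K v) xor (pt (end₂ G e) v ∧ K v)))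
        ≡⟨ *-distribˡ-sum (J e) (λ v → (pt (end₁ G e) v ∧ K v) xor (pt (end₂ G e) v ∧ K v)) ⟨
      J e ∧ ⨁ (λ v → (pt (end₁ G e) v ∧ K v) xor (pt (end₂ G e) v ∧ K v))
        ≡⟨ cong (J e ∧_) (∑-distrib-+ (λ v → pt (end₁ G e) v ∧ K v) (λ v → pt (end₂ G e) v ∧ K v)) ⟩
      J e ∧ (⨁ (λ v → pt (end₁ G e) v ∧ K v) xor ⨁ (λ v → pt (end₂ G e) v ∧ K v))
        ≡⟨ cong (J e ∧_) (cong₂ _xor_ (⨁-pt (end₁ G e) K) (⨁-pt (end₂ G e) K)) ⟩
      J e ∧ crosses G K e ∎

  InU : Sub (nV G) → Sub (nE G) → Set
  InU U J = ∀ e → e ∈ J → InE G U e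

  Joins-∈ : ∀ {U e x z} → InE G U e → Joins G e x z → x ∈ U × z ∈ U
  Joins-∈ (p , q) (inj₁ (refl , refl)) = p , q
  Joins-∈ (p , q) (inj₂ (refl , refl)) = q , p

  Joins-InE : ∀ {U e x z} → Joins G e x z → x ∈ U → z ∈ U → InE G U e
  Joins-InE (inj₁ (refl , refl)) p q = p , q
  Joins-InE (inj₂ (refl , refl)) p q = q , p

  module _ {U : Sub (nV G)} {P : E G → Set} where

    -- Repeated edges cancel, so the boundary formula `∂-eset` holds for all walks and not only for
    -- paths.
    eset : ∀ {x y} → Walk G U P x y → Sub (nE G)
    eset (nil _)          = ∅
    eset (cons e _ _ _ w) = pt e △ eset w

    ∂-eset : ∀ {x y} (w : Walk G U P x y) → ∂ (eset w) ≗ pt x △ pt y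
    ∂-eset (nil {x} _) v = trans (∂-∅ v) (sym (xor-same (pt x v)))
    ∂-eset (cons {x} {z} {y} e _ j _ w) v = begin
      ∂ (pt e △ eset w) v                          ≡⟨ ∂-△ (pt e) (eset w) v ⟩
      ∂ (pt e) v xor ∂ (eset w) v                  ≡⟨ cong₂ _xor_ (trans (∂-pt e v) (inc-Joins j v)) (∂-eset w v) ⟩
      (pt x v xor pt z v) xor (pt z v xor pt y v)  ≡⟨ solve 3 (λ a b c → (a :+ b) :+ (b :+ c) := a :+ c) refl (pt x v) (pt z v) (pt y v) ⟩
      pt x v xor pt y v                            ∎
      where open ≡-Reasoning

    eset-∈ : ∀ {x y} (w : Walk G U P x y) {e} → e ∈ eset w → P e
    eset-∈ (cons e Pe _ _ w) {e'} h with e ≟ e'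
    ... | yes refl = Pe
    ... | no _     = eset-∈ w h

    start∈ : ∀ {x y} → Walk G U P x y → x ∈ U
    start∈ (nil p)          = p
    start∈ (cons _ _ _ p _) = p

    start-verts : ∀ {x y} (w : Walk G U P x y) → x List.∈ verts G w
    start-verts (nil _)          = here refl
    start-verts (cons _ _ _ _ _) = here refl

    eset-InU : ∀ {x y} (w : Walk G U P x y) → InU U (eset w)
    eset-InU (cons e _ j p w) e' h with e ≟ e'
    ... | yes refl = Joins-InE j p (start∈ w)
    ... | no _     = eset-InU w e' h

    eset-verts : ∀ {x y} (w : Walk G U P x y) {e a b} → e ∈ eset w → Joins G e a b → a List.∈ verts G w
    eset-verts (cons e _ j p w) {e'} h k with e ≟ e'
    ... | no _     = there (eset-verts w h k)
    ... | yes refl with j | k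
    ...   | inj₁ (refl , refl) | inj₁ (refl , refl) = here refl
    ...   | inj₁ (refl , refl) | inj₂ (refl , refl) = there (start-verts w)
    ...   | inj₂ (refl , refl) | inj₁ (refl , refl) = there (start-verts w)
    ...   | inj₂ (refl , refl) | inj₂ (refl , refl) = here refl

    suffix : ∀ {x y u} (w : Walk G U P x y) → IsPath G w → u List.∈ verts G w →
      Σ (Walk G U P u y) (IsPath G)
    suffix w@(nil _)            p       (here refl) = w , p
    suffix w@(cons _ _ _ _ _)   p       (here refl) = w , p
    suffix (cons _ _ _ _ w)     (_ ∷ p) (there h)   = suffix w p h

    -- No edge recurs on a path, so each edge alters the size of the symmetric difference by exactly
    -- its sign.
    weight-eset : ∀ F {x y} (w : Walk G U P x y) → IsPath G w →
      + card F ℤ.+ weight G F w ≡ + card (F △ eset w)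
    weight-eset F (nil _) _ = trans (ℤₚ.+-identityʳ _) (cong +_ (card-cong λ e → sym (xor-identityʳ (F e))))
    weight-eset F (cons {x} {z} e _ j _ w) (x∉w ∷ p) = begin
      + card F ℤ.+ (s ℤ.+ weight G F w)  ≡⟨ ℤₚ.+-assoc (+ card F) s _ ⟨
      (+ card F ℤ.+ s) ℤ.+ weight G F w  ≡⟨ cong (ℤ._+ weight G F w) (ℤₚ.+-comm (+ card F) s) ⟩
      (s ℤ.+ + card F) ℤ.+ weight G F w  ≡⟨ ℤₚ.+-assoc s (+ card F) _ ⟩
      s ℤ.+ (+ card F ℤ.+ weight G F w)  ≡⟨ cong (ℤ._+_ s) (weight-eset F w p) ⟩
      s ℤ.+ + card K                     ≡⟨ step Ke ⟩
      + card (K △ pt e)                  ≡⟨ cong +_ (card-cong reorder) ⟩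
      + card (F △ (pt e △ eset w))       ∎
      where
      open ≡-Reasoning
      K = F △ eset w
      s = if F e then -[1+ 0 ] else + 1
      reorder : K △ pt e ≗ F △ (pt e △ eset w)
      reorder i = solve 3 (λ a b c → (a :+ b) :+ c := a :+ (c :+ b)) refl (F i) (eset w i) (pt e i)
      -- If `e` occurred again, the rest of the walk would return to `x`.
      e∉w : eset w e ≡ false
      e∉w with bool-cases (eset w e)
      ... | inj₂ q = q
      ... | inj₁ q = contradiction (eset-verts w q j) (All¬⇒¬Any x∉w)
      Ke : K e ≡ F e
      Ke = trans (cong (F e xor_) e∉w) (xor-identityʳ (F e))
      step : ∀ {b} → K e ≡ b → (if b then -[1+ 0 ] else + 1) ℤ.+ + card K ≡ + card (K △ pt e)
      step {true} h = subst (λ c → -[1+ 0 ] ℤ.+ + c ≡ + card (K △ pt e))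
        (trans (+-comm 1 _) (card-△-pt-∈ K h)) refl
      step {false} h = cong +_ (trans (cong suc (card-cong λ i → sym (△-cancelʳ K (pt e) i)))
        (trans (+-comm 1 _) (card-△-pt-∈ (K △ pt e) (cong₂ _xor_ h (pt-refl e)))))

    weight-⊖ : ∀ F {x y} (w : Walk G U P x y) → IsPath G w →
      weight G F w ≡ card (F △ eset w) ⊖ card F
    weight-⊖ F w p = begin
      weight G F w                                       ≡⟨ ℤₚ.+-identityˡ _ ⟨
      + 0 ℤ.+ weight G F w                               ≡⟨ cong (ℤ._+ weight G F w) (ℤₚ.+-inverseˡ (+ card F)) ⟨
      (ℤ.- (+ card F) ℤ.+ + card F) ℤ.+ weight G F w     ≡⟨ ℤₚ.+-assoc (ℤ.- (+ card F)) (+ card F) _ ⟩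
      ℤ.- (+ card F) ℤ.+ (+ card F ℤ.+ weight G F w)     ≡⟨ cong (ℤ._+_ (ℤ.- (+ card F))) (weight-eset F w p) ⟩
      ℤ.- (+ card F) ℤ.+ + card (F △ eset w)             ≡⟨ ℤₚ.+-comm (ℤ.- (+ card F)) _ ⟩
      + card (F △ eset w) ℤ.- + card F                   ≡⟨ ℤₚ.m-n≡m⊖n (card (F △ eset w)) (card F) ⟩
      card (F △ eset w) ⊖ card F                         ∎
      where open ≡-Reasoning

  mapWalk : ∀ {U P Q x y} → (∀ e → P e → Q e) → (w : Walk G U P x y) →
    Σ (Walk G U Q x y) λ w' → verts G w' ≡ verts G w × eset w' ≡ eset w
  mapWalk f (nil p) = nil p , refl , refl
  mapWalk f (cons {x} e q j p w) with w' , h , k ← mapWalk f w =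
    cons e (f e q) j p w' , cong (x ∷_) h , cong (pt e △_) k

  PathFrom : Sub (nV G) → Sub (nE G) → V G → Set
  PathFrom U J u = ∃ λ u' → u' ≢ u × u' ∈ ∂ J × Σ (Walk G U (_∈ J) u u') (IsPath G)

  △-pt-⊆ : ∀ {J : Sub (nE G)} {e} → e ∈ J → (J △ pt e) ⊆ J
  △-pt-⊆ {J} {e} e∈J e' q with e ≟ e'
  ... | yes refl = e∈J
  ... | no _     = trans (sym (xor-identityʳ (J e'))) q

  extend-path : ∀ {U J e u u' z} → e ∈ J → Joins G e u z → u ∈ U →
    (w : Walk G U (_∈ (J △ pt e)) z u') → IsPath G w → Σ (Walk G U (_∈ J) u u') (IsPath G)
  extend-path {u = u} e∈J j u∈U w p with mapWalk (△-pt-⊆ e∈J) w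
  ... | w' , vs , _ with DecList._∈?_ _≟_ u (verts G w')
  -- The walk already meets `u`: its tail from there is a path, and `e` is discarded.
  ...   | yes u∈w' = suffix w' (subst Unique (sym vs) p) u∈w'
  ...   | no u∉w'  = cons _ e∈J j u∈U w' , ¬Any⇒All¬ _ u∉w' ∷ subst Unique (sym vs) p

  extend-PathFrom : ∀ {U J e u z} → e ∈ J → Joins G e u z → z ≢ u → u ∈ U → u ∈ ∂ J →
    PathFrom U (J △ pt e) z → PathFrom U J u
  extend-PathFrom {U} {J} {e} {u} {z} e∈J j z≢u u∈U u∈∂ (u' , u'≢z , u'∈∂' , w , p) =
    u' , u'≢u , u'∈∂ , extend-path e∈J j u∈U w p
    where
    -- Removing `e` makes `u` even, while `u'` is odd after the removal.
    u'≢u : u' ≢ u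
    u'≢u refl = true≢false u'∈∂' (trans (∂-△-pt J e u) (cong₂ _xor_ u∈∂ (Joins-inc j (z≢u ∘ sym))))
    u'∉e : inc e u' ≡ false
    u'∉e = trans (inc-Joins j u') (cong₂ _xor_ (pt-≢ (u'≢u ∘ sym)) (pt-≢ (u'≢z ∘ sym)))
    u'∈∂ : u' ∈ ∂ J
    u'∈∂ = trans (sym (trans (∂-△-pt J e u') (trans (cong (∂ J u' xor_) u'∉e) (xor-identityʳ _)))) u'∈∂'

  -- Leave `u` along an edge and delete it. If the far end `z` was even it has become odd, and the
  -- search goes on from `z` in a smaller edge set; otherwise `z` is the end sought.
  path-from : ∀ {U J} u → InU U J → u ∈ ∂ J → PathFrom U J u
  path-from {U} {J} u J⊆U h = go (card J) J u ≤-refl J⊆U h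
    where
    go : ∀ k J u → card J ≤ k → InU U J → u ∈ ∂ J → PathFrom U J u
    go k J u J≤k J⊆U h with ∂-edge h
    go zero J u J≤0 _ h | e , e∈J , _ = contradiction (≤-trans (card-∈ {S = J} e∈J) J≤0) λ ()
    go (suc k) J u J≤k J⊆U h | e , e∈J , u∈e with inc-other u∈e
    ... | z , j , z≢u with Joins-∈ {U} (J⊆U e e∈J) j | bool-cases (∂ J z)
    ...   | u∈U , z∈U | inj₁ z∈∂ = z , z≢u , z∈∂ , cons e e∈J j u∈U (nil z∈U) , ((λ u≡z → z≢u (sym u≡z)) ∷ []) ∷ [] ∷ []
    ...   | u∈U , z∈U | inj₂ z∉∂ = extend-PathFrom e∈J j z≢u u∈U h
      (go k (J △ pt e) z
        (≤-pred (≤-trans (≤-reflexive (trans (+-comm 1 _) (card-△-pt-∈ J e∈J))) J≤k))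
        (λ e' q → J⊆U e' (△-pt-⊆ {J} e∈J e' q))
        (trans (∂-△-pt J e z) (cong₂ _xor_ z∉∂ (Joins-inc (Joins-sym j) z≢u))))

  -- Together with `card-△-split` this is the exchange tool: a path inside `J` is traded against the
  -- rest of `J`.
  split-off : ∀ {U J} u → InU U J → u ∈ ∂ J →
    ∃ λ u' → u' ≢ u × u' ∈ ∂ J × ∃ λ K → K ⊆ J × ∂ K ≗ pt u △ pt u'
  split-off {U} u J⊆U h with path-from {U} u J⊆U h
  ... | u' , u'≢u , u'∈∂ , w , _ = u' , u'≢u , u'∈∂ , eset w , (λ e → eset-∈ w) , ∂-eset w

-- Contracting a rooted graph

redirect : Fin n → Fin n → Fin n → Fin n
redirect a b x = if pt a x then b else x

-- The vertex and edge types stay fixed, so `J` means the same edges before and after. For distinct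
-- `a` and `b`, the vertex `a` is left isolated, and the edges between them turn into loops.
contract : (G : Graph) → V G → V G → Graph
contract G a b = record
  { nV = nV G ; nE = nE G ; end₁ = redirect a b ∘ end₁ G ; end₂ = redirect a b ∘ end₂ G }

redirect-≢ : {a b x : Fin n} → a ≢ x → redirect a b x ≡ x
redirect-≢ {b = b} {x} a≢x = cong (if_then b else x) (pt-≢ a≢x)

redirect-≡ : (a b : Fin n) → redirect a b a ≡ b
redirect-≡ a b = cong (if_then b else a) (pt-refl a)

redirect-cases : (a b x : Fin n) → (a ≡ x × redirect a b x ≡ b) ⊎ (a ≢ x × redirect a b x ≡ x)
redirect-cases a b x with a ≟ x
... | yes p = inj₁ (p , refl)
... | no ¬p = inj₂ (¬p , refl)

-- The mod-2 image of a vertex set when a is merged into b.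
push : Fin n → Fin n → Sub n → Sub n
push a b S v = not (pt a v) ∧ (S v xor (pt b v ∧ S a))

push-△ : (a b : Fin n) (S S' : Sub n) → push a b (S △ S') ≗ push a b S △ push a b S'
push-△ a b S S' v =
  solve 6 (λ n s t p u w → n :* ((s :+ t) :+ p :* (u :+ w)) := n :* (s :+ p :* u) :+ n :* (t :+ p :* w)) refl
    (not (pt a v)) (S v) (S' v) (pt b v) (S a) (S' a)

push-pt : {a b : Fin n} → a ≢ b → (x : Fin n) → pt (redirect a b x) ≗ push a b (pt x)
push-pt {a = a} {b} a≢b x v with redirect-cases a b x
... | inj₁ (refl , p) rewrite p | pt-refl a with a ≟ v
...   | yes refl = pt-≢ (a≢b ∘ sym)
...   | no _     = solve 1 (λ x → x := x :* con true) refl (pt b v)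
push-pt {a = a} {b} a≢b x v | inj₂ (a≢x , p) rewrite p | pt-≢ {a = x} (a≢x ∘ sym) with a ≟ v
...   | yes refl = pt-≢ (a≢x ∘ sym)
...   | no _     = solve 2 (λ x b → x := x :+ b :* con false) refl (pt x v) (pt b v)

-- The kernel of merging: modulo 2, the only nonempty set that can cancel is the pair of merged
-- vertices.
push-∅ : {a b : Fin n} → a ≢ b → {S : Sub n} → push a b S ≗ ∅ → S ≗ ∅ ⊎ S ≗ pt a △ pt b
push-∅ {a = a} {b} a≢b {S} h with bool-cases (S a)
... | inj₂ a∉S = inj₁ eq
  where
  eq : S ≗ ∅
  eq v with a ≟ v | h v
  ... | yes refl | _ = a∉S
  ... | no _     | q = trans (solve 2 (λ s b → s := s :+ b :* con false) refl (S v) (pt b v))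
    (trans (cong (λ c → S v xor (pt b v ∧ c)) (sym a∉S)) q)
... | inj₁ a∈S = inj₂ eq
  where
  eq : S ≗ pt a △ pt b
  eq v with a ≟ v | h v
  ... | yes refl | _ = trans a∈S (cong (true xor_) (sym (pt-≢ (a≢b ∘ sym))))
  ... | no _     | q = xor-≡ (trans (solve 2 (λ s b → s :+ b := s :+ b :* con true) refl (S v) (pt b v))
    (trans (cong (λ c → S v xor (pt b v ∧ c)) (sym a∈S)) q))

∂-contract : (G : Graph) {a b : V G} → a ≢ b → ∀ J → ∂ (contract G a b) J ≗ push a b (∂ G J)
∂-contract G {a} {b} a≢b J v = begin
  ⨁ (λ e → J e ∧ inc (contract G a b) e v)
    ≡⟨ ⨁-cong (λ e → trans (cong (J e ∧_) (inc-contract e))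
         (solve 5 (λ j n x p y → j :* (n :* (x :+ p :* y)) := n :* (j :* x :+ p :* (j :* y))) refl
            (J e) (not (pt a v)) (inc G e v) (pt b v) (inc G e a))) ⟩
  ⨁ (λ e → not (pt a v) ∧ ((J e ∧ inc G e v) xor (pt b v ∧ (J e ∧ inc G e a))))
    ≡⟨ *-distribˡ-sum (not (pt a v)) (λ e → (J e ∧ inc G e v) xor (pt b v ∧ (J e ∧ inc G e a))) ⟨
  not (pt a v) ∧ ⨁ (λ e → (J e ∧ inc G e v) xor (pt b v ∧ (J e ∧ inc G e a)))
    ≡⟨ cong (not (pt a v) ∧_) (trans (∑-distrib-+ (λ e → J e ∧ inc G e v) (λ e → pt b v ∧ (J e ∧ inc G e a)))
         (cong (∂ G J v xor_) (sym (*-distribˡ-sum (pt b v) (λ e → J e ∧ inc G e a))))) ⟩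
  push a b (∂ G J) v ∎
  where
  open ≡-Reasoning
  inc-contract : ∀ e → inc (contract G a b) e v ≡ push a b (inc G e) v
  inc-contract e = trans (cong₂ _xor_ (push-pt a≢b (end₁ G e) v) (push-pt a≢b (end₂ G e) v))
    (sym (push-△ a b (pt (end₁ G e)) (pt (end₂ G e)) v))

push-join : (G : Graph) {a b : V G} → a ≢ b → ∀ {T y J} → ∂ G J ≗ T △ pt y →
  ∂ (contract G a b) J ≗ push a b T △ pt (redirect a b y)
push-join G {a} {b} a≢b {T} {y} {J} h v = begin
  ∂ (contract G a b) J v                     ≡⟨ ∂-contract G a≢b J v ⟩
  push a b (∂ G J) v                         ≡⟨ cong₂ (λ s t → not (pt a v) ∧ (s xor (pt b v ∧ t))) (h v) (h a) ⟩
  push a b (T △ pt y) v                      ≡⟨ push-△ a b T (pt y) v ⟩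
  push a b T v xor push a b (pt y) v         ≡⟨ cong (push a b T v xor_) (push-pt a≢b y v) ⟨
  push a b T v xor pt (redirect a b y) v     ∎
  where open ≡-Reasoning

-- The second alternative is the danger in a contraction. `pair-bound` and `shrink` show that such a
-- set is never too small.
pull-join : (G : Graph) {a b : V G} → a ≢ b → ∀ {T y J} → a ≢ y → ∂ (contract G a b) J ≗ push a b T △ pt y →
  ∂ G J ≗ T △ pt y ⊎ ∂ G J ≗ (T △ pt y) △ (pt a △ pt b)
pull-join G {a} {b} a≢b {T} {y} {J} a≢y h = [ inj₁ ∘ left , inj₂ ∘ right ]′ (push-∅ a≢b zero-push)
  where
  open ≡-Reasoning
  left : ∂ G J △ (T △ pt y) ≗ ∅ → ∂ G J ≗ T △ pt y
  left z v = xor-≡ (z v)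
  right : ∂ G J △ (T △ pt y) ≗ pt a △ pt b → ∂ G J ≗ (T △ pt y) △ (pt a △ pt b)
  right z v = trans (sym (△-cancelˡ (T △ pt y) (∂ G J) v))
    (cong ((T △ pt y) v xor_) (trans (xor-comm _ (∂ G J v)) (z v)))
  zero-push : push a b (∂ G J △ (T △ pt y)) ≗ ∅
  zero-push v = begin
    push a b (∂ G J △ (T △ pt y)) v                 ≡⟨ push-△ a b (∂ G J) (T △ pt y) v ⟩
    push a b (∂ G J) v xor push a b (T △ pt y) v    ≡⟨ cong₂ _xor_ (sym (∂-contract G a≢b J v)) (push-△ a b T (pt y) v) ⟩
    ∂ (contract G a b) J v xor (push a b T v xor push a b (pt y) v)
      ≡⟨ cong₂ _xor_ (h v) (cong (push a b T v xor_) (trans (sym (push-pt a≢b y v)) (cong (λ z → pt z v) (redirect-≢ a≢y)))) ⟩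
    (push a b T v xor pt y v) xor (push a b T v xor pt y v) ≡⟨ xor-same (push a b T v xor pt y v) ⟩
    false ∎

-- Vertices outside Act have been merged into others and carry no edges, so q is arbitrary there;
-- conn says that G − r is connected, loops being harmless throughout.
record Levelled (G : Graph) (T Act : Sub (nV G)) (q : V G → ℕ) (r : V G) : Set where
  field
    ends∈    : ∀ e → end₁ G e ∈ Act × end₂ G e ∈ Act
    root∈    : r ∈ Act
    other    : ∃ λ y → y ∈ Act × y ≢ r
    attained : ∀ {y} → y ∈ Act → ∃ λ J → ∂ G J ≗ T △ pt y × card J ≡ q y
    lower    : ∀ {y J} → y ∈ Act → ∂ G J ≗ T △ pt y → q y ≤ card J
    below    : ∀ {y} → y ∈ Act → y ≢ r → q y < q r
    step     : ∀ e → end₁ G e ≢ end₂ G e → q (end₁ G e) ≢ q (end₂ G e)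
    conn     : ∀ (K : Sub (nV G)) → (∀ e → end₁ G e ≢ r → end₂ G e ≢ r → K (end₁ G e) ≡ K (end₂ G e)) →
               ∀ {x y} → x ∈ Act → y ∈ Act → x ≢ r → y ≢ r → K x ≡ K y

CutAtRoot : (G : Graph) (T Act : Sub (nV G)) (q : V G → ℕ) (r : V G) → Set
CutAtRoot G T Act q r =
  (∀ {J} → ∂ G J ≗ T △ pt r → card J ≡ q r → card (λ e → J e ∧ inc G e r) ≡ 1) ×
  (∀ {y J} → y ∈ Act → y ≢ r → ∂ G J ≗ T △ pt y → card J ≡ q y → ∀ {e} → e ∈ J → inc G e r ≡ false)

∈-∖ : {S : Sub n} {a y : Fin n} → y ∈ (S ∖ pt a) → y ∈ S × a ≢ y
∈-∖ {a = a} {y} h with ∧-true h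
... | p , q = p , λ { refl → true≢false q (cong not (pt-refl a)) }

∖-∈ : {S : Sub n} {a y : Fin n} → y ∈ S → a ≢ y → y ∈ (S ∖ pt a)
∖-∈ p a≢y = ∧-intro p (cong not (pt-≢ a≢y))

card-∖ : {S : Sub n} {a : Fin n} → a ∈ S → card (S ∖ pt a) + 1 ≡ card S
card-∖ {S = S} {a} a∈S = trans (cong (_+ 1) (card-cong eq)) (card-△-pt-∈ S a∈S)
  where
  eq : S ∖ pt a ≗ S △ pt a
  eq v with a ≟ v
  ... | yes refl rewrite a∈S = refl
  ... | no _ = solve 1 (λ s → s :* con true := s :+ con false) refl (S v)

-- Contractions at a vertex of lowest level

module _ {G : Graph} {T Act : Sub (nV G)} {q : V G → ℕ} {r : V G} (L : Levelled G T Act q r) where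
  open Levelled L

  flip-end : ∀ {J e y z} → ∂ G J ≗ T △ pt y → Joins G e y z → ∂ G (J △ pt e) ≗ T △ pt z
  flip-end {J} {e} {y} {z} h j x = trans (∂-△-pt G J e x) (trans (cong₂ _xor_ (h x) (inc-Joins G j x))
    (solve 3 (λ t a b → (t :+ a) :+ (a :+ b) := t :+ b) refl (T x) (pt y x) (pt z x)))

  Joins-Act : ∀ {e y z} → Joins G e y z → y ∈ Act × z ∈ Act
  Joins-Act {e} = Joins-∈ G (ends∈ e)

  adjacent-≤ : ∀ {e y z} → Joins G e y z → q z ≤ q y + 1
  adjacent-≤ {e} {y} {z} j with Joins-Act j
  ... | y∈ , z∈ with attained y∈
  ...   | J , ∂J , c = ≤-trans (lower z∈ (flip-end ∂J j))
    (≤-trans (card-△-pt-≤ J e) (≤-reflexive (cong (_+ 1) c)))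

  adjacent-≢ : ∀ {e y z} → Joins G e y z → y ≢ z → q y ≢ q z
  adjacent-≢ {e} (inj₁ (refl , refl)) y≢z = step e y≢z
  adjacent-≢ {e} (inj₂ (refl , refl)) y≢z = step e (y≢z ∘ sym) ∘ sym

  lowest : ∃ λ v → v ∈ Act × v ≢ r × (∀ {y} → y ∈ Act → q v ≤ q y)
  lowest with other
  ... | y₀ , y₀∈ , y₀≢ = go y₀ y₀∈ y₀≢ (<-wellFounded (q y₀))
    where
    go : ∀ v → v ∈ Act → v ≢ r → Acc _<_ (q v) → ∃ λ v → v ∈ Act × v ≢ r × (∀ {y} → y ∈ Act → q v ≤ q y)
    go v v∈ v≢r (acc rs) with any? (λ y → (Act y ≟ᵇ true) ×-dec (q y <? q v))
    ... | no ¬lower = v , v∈ , v≢r , λ {y} y∈ → ≮⇒≥ λ l → ¬lower (y , y∈ , l)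
    -- A vertex below `v` is not the root, since the root lies above `v`.
    ... | yes (y , y∈ , l) = go y y∈ (λ { refl → <-asym l (below v∈ v≢r) }) (rs l)

  contract-ends : ∀ {a b} → a ≢ b → b ∈ Act → ∀ x → x ∈ Act → redirect a b x ∈ (Act ∖ pt a)
  contract-ends {a} {b} a≢b b∈ x x∈ with redirect-cases a b x
  ... | inj₁ (_ , p)   = subst (_∈ (Act ∖ pt a)) (sym p) (∖-∈ {S = Act} b∈ a≢b)
  ... | inj₂ (a≢x , p) = subst (_∈ (Act ∖ pt a)) (sym p) (∖-∈ {S = Act} x∈ a≢x)

  redirect-≢r : ∀ {a b} → b ≢ r → ∀ x → x ≢ r → redirect a b x ≢ r
  redirect-≢r {a} {b} b≢r x x≢r h with redirect-cases a b x
  ... | inj₁ (_ , p) = b≢r (trans (sym p) h)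
  ... | inj₂ (_ , p) = x≢r (trans (sym p) h)

  contract-conn : ∀ {a b} → b ≢ r → ∀ (K : Sub (nV G)) →
    (∀ e → redirect a b (end₁ G e) ≢ r → redirect a b (end₂ G e) ≢ r →
      K (redirect a b (end₁ G e)) ≡ K (redirect a b (end₂ G e))) →
    ∀ {x y} → x ∈ (Act ∖ pt a) → y ∈ (Act ∖ pt a) → x ≢ r → y ≢ r → K x ≡ K y
  contract-conn {a} {b} b≢r K h {x} {y} x∈ y∈ x≢r y≢r with ∈-∖ {S = Act} x∈ | ∈-∖ {S = Act} y∈
  ... | x∈A , a≢x | y∈A , a≢y = subst₂ (λ s t → K s ≡ K t) (redirect-≢ a≢x) (redirect-≢ a≢y)
    (conn (K ∘ redirect a b) (λ e s≢r t≢r → h e (redirect-≢r b≢r _ s≢r) (redirect-≢r b≢r _ t≢r)) x∈A y∈A x≢r y≢r)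

  inc-contract-root : ∀ {a b} → a ≢ b → a ≢ r → b ≢ r → ∀ e → inc (contract G a b) e r ≡ inc G e r
  inc-contract-root {a} {b} a≢b a≢r b≢r e = cong₂ _xor_ (eq (end₁ G e)) (eq (end₂ G e))
    where
    eq : ∀ x → pt (redirect a b x) r ≡ pt x r
    eq x with redirect-cases a b x
    ... | inj₁ (refl , p) = trans (cong (λ z → pt z r) p) (trans (pt-≢ b≢r) (sym (pt-≢ a≢r)))
    ... | inj₂ (_ , p)    = cong (λ z → pt z r) p

  module Lowest {v} (v∈ : v ∈ Act) (v≢r : v ≢ r) (v-min : ∀ {y} → y ∈ Act → q v ≤ q y) where

    -- Dropping an edge from `v` to `z` would leave a join for `z` with fewer than q v edges,
    -- against the choice of `v`.
    isolated : ∀ {J} → ∂ G J ≗ T △ pt v → card J ≡ q v → ∀ {e} → e ∈ J → inc G e v ≡ false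
    isolated {J} ∂J c {e} e∈J with bool-cases (inc G e v)
    ... | inj₂ p = p
    ... | inj₁ p with inc-other G p
    ...   | z , j , _ = contradiction
      (≤-trans (v-min (proj₂ (Joins-Act j))) (lower (proj₂ (Joins-Act j)) (flip-end ∂J j)))
      (<⇒≱ (≤-reflexive (trans (+-comm 1 _) (trans (card-△-pt-∈ J e∈J) c))))

    -- A minimum join for `v` avoids `v`, and its even degree there forces `v` into T. Joins for
    -- other vertices then have odd degree at `v`, whence `edge-at`.
    v∈T : v ∈ T
    v∈T with attained v∈
    ... | J , ∂J , c = xor-≡ (trans (cong (T v xor_) (sym (pt-refl v)))
      (trans (sym (∂J v)) (∂-isolated G λ e e∈J → isolated ∂J c e∈J)))

    edge-at : ∀ {y J} → y ≢ v → ∂ G J ≗ T △ pt y → ∃ λ e → e ∈ J × v ∈ inc G e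
    edge-at {y} y≢v ∂J = ∂-edge G (trans (∂J v) (cong₂ _xor_ v∈T (pt-≢ y≢v)))

    neighbour-level : ∀ {e z} → Joins G e v z → z ≢ v → q z ≡ q v + 1
    neighbour-level j z≢v = ≤-antisym (adjacent-≤ j)
      (≤-trans (≤-reflexive (+-comm _ 1)) (≤∧≢⇒< (v-min (proj₂ (Joins-Act j))) (adjacent-≢ j (z≢v ∘ sym))))

    -- Since q r = q v + 1 exceeds all other levels, every vertex but `r` has level q v. Levels
    -- differ along edges, so G - r has only loops and, being connected, is `v` alone. A minimum
    -- join for `r` is then one edge from `v` to `r` added to a minimum join for `v`, which avoids
    -- `v` and hence the root.
    cut-base : ∀ {e} → Joins G e v r → CutAtRoot G T Act q r
    cut-base {e} j = root , off
      where
      same-level : ∀ {y} → y ∈ Act → y ≢ r → q y ≡ q v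
      same-level y∈ y≢r = ≤-antisym
        (≤-pred (≤-trans (below y∈ y≢r) (≤-reflexive (trans (neighbour-level j (v≢r ∘ sym)) (+-comm _ 1))))) (v-min y∈)
      loops : ∀ e → end₁ G e ≢ r → end₂ G e ≢ r → pt v (end₁ G e) ≡ pt v (end₂ G e)
      loops e s≢r t≢r with end₁ G e ≟ end₂ G e
      ... | yes p = cong (pt v) p
      ... | no s≢t = contradiction
        (trans (same-level (proj₁ (ends∈ e)) s≢r) (sym (same-level (proj₂ (ends∈ e)) t≢r))) (step e s≢t)
      only-v : ∀ {y} → y ∈ Act → y ≢ r → v ≡ y
      only-v y∈ y≢r = pt-≡ (trans (conn (pt v) loops y∈ v∈ y≢r v≢r) (pt-refl v))
      inc-v : ∀ {e} → r ∈ inc G e → v ∈ inc G e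
      inc-v {e} r∈e with inc-other G r∈e
      ... | z , j' , z≢r = Joins-inc G
        (subst (λ w → Joins G e w r) (sym (only-v (proj₂ (Joins-Act j')) z≢r)) (Joins-sym G j')) v≢r
      off-v : ∀ {J} → ∂ G J ≗ T △ pt v → card J ≡ q v → ∀ {e} → e ∈ J → inc G e r ≡ false
      off-v ∂J c {e} e∈J with bool-cases (inc G e r)
      ... | inj₂ p = p
      ... | inj₁ p = contradiction (isolated ∂J c e∈J) (true≢false (inc-v p))
      off : ∀ {y J} → y ∈ Act → y ≢ r → ∂ G J ≗ T △ pt y → card J ≡ q y → ∀ {e} → e ∈ J → inc G e r ≡ false
      off y∈ y≢r ∂J c e∈J with only-v y∈ y≢r
      ... | refl = off-v ∂J c e∈J
      root : ∀ {J} → ∂ G J ≗ T △ pt r → card J ≡ q r → card (λ e → J e ∧ inc G e r) ≡ 1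
      root {J} ∂J c with edge-at (v≢r ∘ sym) ∂J
      ... | e' , e'∈J , v∈e' with inc-other G v∈e'
      ...   | z , j' , z≢v with z ≟ r
      ...     | no z≢r = contradiction (sym (only-v (proj₂ (Joins-Act j')) z≢r)) z≢v
      ...     | yes refl = trans (card-cong eq) (card-pt e')
        where
        J' = J △ pt e'
        ∂J' : ∂ G J' ≗ T △ pt v
        ∂J' = flip-end ∂J (Joins-sym G j')
        c' : card J' ≡ q v
        c' = +-cancelʳ-≡ 1 _ _ (trans (card-△-pt-∈ J e'∈J) (trans c (neighbour-level j (v≢r ∘ sym))))
        eq : (λ e → J e ∧ inc G e r) ≗ pt e'
        eq e with e' ≟ e
        ... | yes refl = ∧-intro e'∈J (Joins-inc G (Joins-sym G j') (v≢r ∘ sym))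
        ... | no e'≢e with bool-cases (J e)
        ...   | inj₂ p = cong (_∧ inc G e r) p
        ...   | inj₁ p = cong₂ _∧_ p (off-v ∂J' c' (trans (cong (J e xor_) (pt-≢ e'≢e)) (trans (xor-identityʳ _) p)))

    module Pair {a b ea eb} (a≢b : a ≢ b) (ja : Joins G ea v a) (jb : Joins G eb v b) (a≢v : a ≢ v) (b≢v : b ≢ v) where

      a∈ : a ∈ Act
      a∈ = proj₂ (Joins-Act ja)
      b∈ : b ∈ Act
      b∈ = proj₂ (Joins-Act jb)

      -- Toggling `eb` turns `J` into a join for `a`, whose level q v + 1 absorbs the extra edge.
      pair-bound-v : ∀ {J} → ∂ G J ≗ (T △ pt v) △ (pt a △ pt b) → q v ≤ card J
      pair-bound-v {J} ∂J = +-cancelʳ-≤ 1 _ _ (begin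
        q v + 1              ≡⟨ neighbour-level ja a≢v ⟨
        q a                  ≤⟨ lower a∈ ∂J' ⟩
        card (J △ pt eb)     ≤⟨ card-△-pt-≤ J eb ⟩
        card J + 1           ∎)
        where
        open ≤-Reasoning
        ∂J' : ∂ G (J △ pt eb) ≗ T △ pt a
        ∂J' x = trans (∂-△-pt G J eb x) (trans (cong₂ _xor_ (∂J x) (inc-Joins G jb x))
          (solve 4 (λ t v a b → ((t :+ v) :+ (a :+ b)) :+ (v :+ b) := t :+ a) refl (T x) (pt v x) (pt a x) (pt b x)))

      -- For a minimum (T △ pt v)-join R, split J △ R at a into a {a , u'}-join K and its
      -- complement K' in it; |R △ K| and |R △ K'| add up to at most q v + |J|.
      pair-bound : ∀ {y J} → y ∈ Act → y ≢ a → ∂ G J ≗ (T △ pt y) △ (pt a △ pt b) → q y ≤ card J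
      pair-bound {y} {J} y∈ y≢a ∂J with y ≟ b | y ≟ v
      ... | yes refl | _ = ≤-trans (≤-reflexive (trans (neighbour-level jb b≢v) (sym (neighbour-level ja a≢v))))
        (lower a∈ λ x → trans (∂J x)
          (solve 3 (λ t a b → (t :+ b) :+ (a :+ b) := t :+ a) refl (T x) (pt a x) (pt b x)))
      ... | no _ | yes refl = pair-bound-v ∂J
      ... | no y≢b | no y≢v with attained v∈
      ...   | R , ∂R , cR = finish (split-off G {full} a (λ _ _ → refl , refl) a∈∂D)
        where
        open ≤-Reasoning
        D = J △ R
        ∂D : ∂ G D ≗ (pt y △ pt v) △ (pt a △ pt b)
        ∂D x = trans (∂-△ G J R x) (trans (cong₂ _xor_ (∂J x) (∂R x))
          (solve 5 (λ t v y a b → ((t :+ y) :+ (a :+ b)) :+ (t :+ v) := (y :+ v) :+ (a :+ b)) refl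
            (T x) (pt v x) (pt y x) (pt a x) (pt b x)))
        a∈∂D : a ∈ ∂ G D
        a∈∂D = trans (∂D a) (cong₂ _xor_ (cong₂ _xor_ (pt-≢ y≢a) (pt-≢ (a≢v ∘ sym)))
          (cong₂ _xor_ (pt-refl a) (pt-≢ (a≢b ∘ sym))))
        total : ∀ {K} → K ⊆ D → card (R △ K) + card (R △ (D △ K)) ≤ q v + card J
        total K⊆D = ≤-trans (card-△-split R K⊆D) (≤-reflexive (cong₂ _+_ cR (card-cong λ e →
          solve 2 (λ r j → r :+ (j :+ r) := j) refl (R e) (J e))))
        ∂RK : ∀ {K u'} → ∂ G K ≗ pt a △ pt u' → ∀ x → ∂ G (R △ K) x ≡ (T x xor pt v x) xor (pt a x xor pt u' x)
        ∂RK {K} ∂K x = trans (∂-△ G R K x) (cong₂ _xor_ (∂R x) (∂K x))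
        ∂RK' : ∀ {K u'} → ∂ G K ≗ pt a △ pt u' → ∀ x → ∂ G (R △ (D △ K)) x ≡ (T x xor pt y x) xor (pt b x xor pt u' x)
        ∂RK' {K} {u'} ∂K x = trans (∂-△ G R (D △ K) x)
          (trans (cong₂ _xor_ (∂R x) (trans (∂-△ G D K x) (cong₂ _xor_ (∂D x) (∂K x))))
            (solve 6 (λ t v y a b u → (t :+ v) :+ (((y :+ v) :+ (a :+ b)) :+ (a :+ u)) := (t :+ y) :+ (b :+ u)) refl
              (T x) (pt v x) (pt y x) (pt a x) (pt b x) (pt u' x)))
        finish : (∃ λ u' → u' ≢ a × u' ∈ ∂ G D × ∃ λ K → K ⊆ D × ∂ G K ≗ pt a △ pt u') → q y ≤ card J
        finish (u' , u'≢a , u'∈∂D , K , K⊆D , ∂K) with u' ≟ b | u' ≟ v | u' ≟ y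
        -- Here `R △ K` is wrong by {a , b} but belongs to `v`, the case already bounded; the other
        -- half is a join for `y`.
        ... | yes refl | _ | _ = +-cancelˡ-≤ (q v) _ _ (≤-trans
          (+-mono-≤ (pair-bound-v (∂RK ∂K))
            (lower y∈ λ x → trans (∂RK' ∂K x) (solve 3 (λ t y b → (t :+ y) :+ (b :+ b) := t :+ y) refl (T x) (pt y x) (pt b x))))
          (total K⊆D))
        -- Here `R △ K` is a join for `a` and has at least q v + 1 edges; the surplus pays for the
        -- edge `eb` that makes `K'` a join for `y`.
        ... | no _ | yes refl | _ = +-cancelˡ-≤ (q v) _ _ (begin
          q v + q y                             ≤⟨ +-monoʳ-≤ (q v) (lower y∈ ∂K'b) ⟩
          q v + card (K' △ pt eb)               ≤⟨ +-monoʳ-≤ (q v) (card-△-pt-≤ K' eb) ⟩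
          q v + (card K' + 1)                   ≡⟨ cong (_+_ (q v)) (+-comm _ 1) ⟩
          q v + (1 + card K')                   ≡⟨ +-assoc (q v) 1 _ ⟨
          q v + 1 + card K'                     ≡⟨ cong (_+ card K') (neighbour-level ja a≢v) ⟨
          q a + card K'                         ≤⟨ +-monoˡ-≤ (card K') (lower a∈ λ x → trans (∂RK ∂K x)
            (solve 3 (λ t v a → (t :+ v) :+ (a :+ v) := t :+ a) refl (T x) (pt v x) (pt a x))) ⟩
          card (R △ K) + card K'                ≤⟨ total K⊆D ⟩
          q v + card J                          ∎)
          where
          K' = R △ (D △ K)
          ∂K'b : ∂ G (K' △ pt eb) ≗ T △ pt y
          ∂K'b x = trans (∂-△-pt G K' eb x) (trans (cong₂ _xor_ (∂RK' ∂K x) (inc-Joins G jb x))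
            (solve 4 (λ t y b v → ((t :+ y) :+ (b :+ v)) :+ (v :+ b) := t :+ y) refl (T x) (pt y x) (pt b x) (pt v x)))
        -- The mirror case: the other half is a join for `b`, and its surplus pays for `ea`.
        ... | no _ | no _ | yes refl = +-cancelˡ-≤ (q v) _ _ (begin
          q v + q y                             ≤⟨ +-monoʳ-≤ (q v) (lower y∈ ∂Ka) ⟩
          q v + card ((R △ K) △ pt ea)          ≤⟨ +-monoʳ-≤ (q v) (card-△-pt-≤ (R △ K) ea) ⟩
          q v + (card (R △ K) + 1)              ≡⟨ cong (_+_ (q v)) (+-comm _ 1) ⟩
          q v + (1 + card (R △ K))              ≡⟨ +-assoc (q v) 1 _ ⟨
          q v + 1 + card (R △ K)                ≡⟨ cong (_+ card (R △ K)) (neighbour-level jb b≢v) ⟨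
          q b + card (R △ K)                    ≤⟨ +-monoˡ-≤ (card (R △ K)) (lower b∈ λ x → trans (∂RK' ∂K x)
            (solve 3 (λ t y b → (t :+ y) :+ (b :+ y) := t :+ b) refl (T x) (pt y x) (pt b x))) ⟩
          card (R △ (D △ K)) + card (R △ K)     ≡⟨ +-comm (card (R △ (D △ K))) _ ⟩
          card (R △ K) + card (R △ (D △ K))     ≤⟨ total K⊆D ⟩
          q v + card J                          ∎)
          where
          ∂Ka : ∂ G ((R △ K) △ pt ea) ≗ T △ pt y
          ∂Ka x = trans (∂-△-pt G (R △ K) ea x) (trans (cong₂ _xor_ (∂RK ∂K x) (inc-Joins G ja x))
            (solve 4 (λ t y a v → ((t :+ v) :+ (a :+ y)) :+ (v :+ a) := t :+ y) refl (T x) (pt y x) (pt a x) (pt v x)))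
        ... | no u'≢b | no u'≢v | no u'≢y = contradiction u'∈∂D λ p → true≢false p (trans (∂D u')
          (cong₂ _xor_ (cong₂ _xor_ (pt-≢ (u'≢y ∘ sym)) (pt-≢ (u'≢v ∘ sym)))
            (cong₂ _xor_ (pt-≢ (u'≢a ∘ sym)) (pt-≢ (u'≢b ∘ sym)))))
      module _ (a≢r : a ≢ r) (b≢r : b ≢ r) where

        -- Both neighbours lie one level above `v`, so q is well defined on the merged vertex.
        q-redirect : ∀ x → q (redirect a b x) ≡ q x
        q-redirect x with redirect-cases a b x
        ... | inj₁ (refl , p) = trans (cong q p) (trans (neighbour-level jb b≢v) (sym (neighbour-level ja a≢v)))
        ... | inj₂ (_ , p)    = cong q p

        identify : Levelled (contract G a b) (push a b T) (Act ∖ pt a) q r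
        identify = record
          { ends∈    = λ e → contract-ends a≢b b∈ _ (proj₁ (ends∈ e)) , contract-ends a≢b b∈ _ (proj₂ (ends∈ e))
          ; root∈    = ∖-∈ {S = Act} root∈ a≢r
          ; other    = v , ∖-∈ {S = Act} v∈ a≢v , v≢r
          ; attained = att
          ; lower    = low
          ; below    = λ y∈ → below (proj₁ (∈-∖ {S = Act} y∈))
          ; step     = λ e s≢t → subst₂ _≢_ (sym (q-redirect _)) (sym (q-redirect _))
                         (step e (s≢t ∘ cong (redirect a b)))
          ; conn     = contract-conn b≢r
          }
          where
          att : ∀ {y} → y ∈ (Act ∖ pt a) → ∃ λ J → ∂ (contract G a b) J ≗ push a b T △ pt y × card J ≡ q y
          att {y} y∈ with ∈-∖ {S = Act} y∈
          ... | y∈A , a≢y with attained y∈A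
          ...   | J , ∂J , c = J , subst (λ z → ∂ (contract G a b) J ≗ push a b T △ pt z) (redirect-≢ a≢y)
            (push-join G a≢b {T} ∂J) , c
          low : ∀ {y J} → y ∈ (Act ∖ pt a) → ∂ (contract G a b) J ≗ push a b T △ pt y → q y ≤ card J
          low {y} {J} y∈ ∂J with ∈-∖ {S = Act} y∈
          ... | y∈A , a≢y = [ lower y∈A , pair-bound y∈A (a≢y ∘ sym) ]′ (pull-join G a≢b {T} a≢y ∂J)

        cut-identify : CutAtRoot (contract G a b) (push a b T) (Act ∖ pt a) q r → CutAtRoot G T Act q r
        cut-identify (root' , off') = root , off
          where
          root : ∀ {J} → ∂ G J ≗ T △ pt r → card J ≡ q r → card (λ e → J e ∧ inc G e r) ≡ 1
          root {J} ∂J c = trans (card-cong λ e → cong (J e ∧_) (sym (inc-contract-root a≢b a≢r b≢r e)))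
            (root' (subst (λ z → ∂ (contract G a b) J ≗ push a b T △ pt z) (redirect-≢ a≢r) (push-join G a≢b {T} ∂J)) c)
          off : ∀ {y J} → y ∈ Act → y ≢ r → ∂ G J ≗ T △ pt y → card J ≡ q y → ∀ {e} → e ∈ J → inc G e r ≡ false
          off {y} y∈ y≢r ∂J c {e} e∈J = trans (sym (inc-contract-root a≢b a≢r b≢r e))
            (off' (contract-ends a≢b b∈ y y∈) (redirect-≢r b≢r y y≢r) (push-join G a≢b {T} ∂J)
              (trans c (sym (q-redirect y))) e∈J)

    module Pendant {u e₀} (j₀ : Joins G e₀ v u) (u≢v : u ≢ v) (u≢r : u ≢ r)
      (only : ∀ e → v ∈ inc G e → u ∈ inc G e) where

      v≢u : v ≢ u
      v≢u = u≢v ∘ sym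

      G' : Graph
      G' = contract G v u
      q' : V G → ℕ
      q' y = q y ∸ 1

      u∈ : u ∈ Act
      u∈ = proj₂ (Joins-Act j₀)

      joins-u : ∀ {e} → v ∈ inc G e → Joins G e v u
      joins-u {e} v∈e with inc-other G v∈e
      ... | z , j , _ = subst (Joins G e v) (pt-≡ (trans (cong (_xor pt z u) (sym (pt-≢ v≢u)))
        (trans (sym (inc-Joins G j u)) (only e v∈e)))) j

      joins-loop : ∀ {e} → Joins G e v u → end₁ G' e ≡ end₂ G' e
      joins-loop (inj₁ (p , s)) = trans (cong (redirect v u) p) (trans (redirect-≡ v u)
        (sym (trans (cong (redirect v u) s) (redirect-≢ v≢u))))
      joins-loop (inj₂ (p , s)) = trans (trans (cong (redirect v u) s) (redirect-≢ v≢u))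
        (sym (trans (cong (redirect v u) p) (redirect-≡ v u)))

      drop-join : ∀ {y J e} → ∂ G J ≗ T △ pt y → Joins G e v u →
        ∂ G' (J △ pt e) ≗ push v u T △ pt (redirect v u y)
      drop-join {y} {J} {e} ∂J j x = trans (∂-△-pt G' J e x)
        (trans (cong (∂ G' J x xor_) (trans (cong (λ z → pt z x xor pt (end₂ G' e) x) (joins-loop j)) (xor-same (pt (end₂ G' e) x))))
          (trans (xor-identityʳ _) (push-join G v≢u {T} ∂J x)))

      drop-join-≢ : ∀ {y J e} → v ≢ y → ∂ G J ≗ T △ pt y → Joins G e v u → ∂ G' (J △ pt e) ≗ push v u T △ pt y
      drop-join-≢ {y} {J} {e} v≢y ∂J j = subst (λ z → ∂ G' (J △ pt e) ≗ push v u T △ pt z) (redirect-≢ v≢y) (drop-join ∂J j)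

      drop-card : ∀ {y} {J : Sub (nE G)} {e} → card J ≡ q y → e ∈ J → card (J △ pt e) ≡ q' y
      drop-card {y} {J} {e} c e∈J = trans (sym (m+n∸n≡m _ 1)) (cong (_∸ 1) (trans (card-△-pt-∈ J e∈J) c))

      -- Makes the truncated subtraction in `q'` a true one away from `v`.
      positive : ∀ {y} → y ∈ Act → y ≢ v → 1 ≤ q y
      positive y∈ y≢v with attained y∈
      ... | J , ∂J , c with edge-at y≢v ∂J
      ...   | e , e∈J , _ = subst (1 ≤_) c (card-∈ {S = J} e∈J)

      -- A join for any vertex other than `v` has a non-loop edge at `v`. All of these lead to `u`
      -- and become loops, so one can be deleted, which saves exactly one edge.
      shrink : Levelled G' (push v u T) (Act ∖ pt v) q' r
      shrink = record
        { ends∈    = λ e → contract-ends v≢u u∈ _ (proj₁ (ends∈ e)) , contract-ends v≢u u∈ _ (proj₂ (ends∈ e))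
        ; root∈    = ∖-∈ {S = Act} root∈ v≢r
        ; other    = u , ∖-∈ {S = Act} u∈ v≢u , u≢r
        ; attained = att
        ; lower    = low
        ; below    = bel
        ; step     = stp
        ; conn     = contract-conn u≢r
        }
        where
        att : ∀ {y} → y ∈ (Act ∖ pt v) → ∃ λ J → ∂ G' J ≗ push v u T △ pt y × card J ≡ q' y
        att {y} y∈ with ∈-∖ {S = Act} y∈
        ... | y∈A , v≢y with attained y∈A
        ...   | J , ∂J , c with edge-at (v≢y ∘ sym) ∂J
        ...     | e , e∈J , v∈e = J △ pt e , drop-join-≢ {y} {J} {e} v≢y ∂J (joins-u v∈e) , drop-card {y} {J} {e} c e∈J
        low : ∀ {y J} → y ∈ (Act ∖ pt v) → ∂ G' J ≗ push v u T △ pt y → q' y ≤ card J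
        low {y} {J} y∈ ∂J with ∈-∖ {S = Act} y∈
        ... | y∈A , v≢y = [ left , right ]′ (pull-join G v≢u {T} v≢y ∂J)
          where
          left : ∂ G J ≗ T △ pt y → q' y ≤ card J
          left ∂J₁ = ≤-trans (m∸n≤m _ 1) (lower y∈A ∂J₁)
          -- The edge `e₀` repairs the boundary, at the price of the one edge by which `q'` is
          -- smaller than `q`.
          right : ∂ G J ≗ (T △ pt y) △ (pt v △ pt u) → q' y ≤ card J
          right ∂J₂ = ≤-trans (∸-monoˡ-≤ 1 (≤-trans (lower y∈A ∂J₃) (card-△-pt-≤ J e₀)))
            (≤-reflexive (m+n∸n≡m _ 1))
            where
            ∂J₃ : ∂ G (J △ pt e₀) ≗ T △ pt y
            ∂J₃ x = trans (∂-△-pt G J e₀ x) (trans (cong₂ _xor_ (∂J₂ x) (inc-Joins G j₀ x))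
              (△-cancelʳ (T △ pt y) (pt v △ pt u) x))
        bel : ∀ {y} → y ∈ (Act ∖ pt v) → y ≢ r → q' y < q' r
        bel y∈ y≢r with ∈-∖ {S = Act} y∈
        ... | y∈A , v≢y = ∸-monoˡ-< (below y∈A y≢r) (positive y∈A (v≢y ∘ sym))
        stp : ∀ e → end₁ G' e ≢ end₂ G' e → q' (end₁ G' e) ≢ q' (end₂ G' e)
        stp e s≢t with bool-cases (inc G e v)
        ... | inj₁ v∈e = contradiction (joins-loop (joins-u v∈e)) s≢t
        ... | inj₂ v∉e with redirect-cases v u (end₁ G e) | redirect-cases v u (end₂ G e)
        ...   | inj₁ (p , _) | inj₁ (p' , _) = contradiction (cong (redirect v u) (trans (sym p) p')) s≢t
        ...   | inj₁ (p , _) | inj₂ (n , _)  = contradiction v∉e (true≢false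
          (cong₂ _xor_ (trans (cong (λ z → pt z v) (sym p)) (pt-refl v)) (pt-≢ (n ∘ sym))))
        ...   | inj₂ (n , _) | inj₁ (p , _)  = contradiction v∉e (true≢false
          (cong₂ _xor_ (pt-≢ (n ∘ sym)) (trans (cong (λ z → pt z v) (sym p)) (pt-refl v))))
        ...   | inj₂ (n , p) | inj₂ (n' , p') rewrite p | p' = λ h → step e s≢t
          (∸-cancelʳ-≡ (positive (proj₁ (ends∈ e)) (n ∘ sym)) (positive (proj₂ (ends∈ e)) (n' ∘ sym)) h)

      cut-shrink : CutAtRoot G' (push v u T) (Act ∖ pt v) q' r → CutAtRoot G T Act q r
      cut-shrink (root' , off') = root , off
        where
        not-root : ∀ {e} → Joins G e v u → inc G e r ≡ false
        not-root j = trans (inc-Joins G j r) (cong₂ _xor_ (pt-≢ v≢r) (pt-≢ u≢r))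
        root : ∀ {J} → ∂ G J ≗ T △ pt r → card J ≡ q r → card (λ e → J e ∧ inc G e r) ≡ 1
        root {J} ∂J c with edge-at (v≢r ∘ sym) ∂J
        ... | e , e∈J , v∈e = trans (card-cong eq) (root' (drop-join-≢ v≢r ∂J (joins-u v∈e)) (drop-card c e∈J))
          where
          eq : ∀ i → J i ∧ inc G i r ≡ (J △ pt e) i ∧ inc G' i r
          eq i rewrite inc-contract-root v≢u v≢r u≢r i with e ≟ i
          ... | yes refl rewrite not-root (joins-u v∈e) = trans (∧-zeroʳ (J e)) (sym (∧-zeroʳ (J e xor true)))
          ... | no _ = cong (_∧ inc G i r) (sym (xor-identityʳ (J i)))
        off : ∀ {y J} → y ∈ Act → y ≢ r → ∂ G J ≗ T △ pt y → card J ≡ q y → ∀ {e} → e ∈ J → inc G e r ≡ false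
        off {y} {J} y∈ y≢r ∂J c {i} i∈J with v ≟ y
        -- Joins for `v` become joins for `u`, and q' u = q v because `u` lies one level above `v`.
        ... | yes refl = trans (sym (inc-contract-root v≢u v≢r u≢r i))
          (off' (∖-∈ {S = Act} u∈ v≢u) u≢r
            (subst (λ z → ∂ G' J ≗ push v u T △ pt z) (redirect-≡ v u) (push-join G v≢u {T} ∂J))
            (trans c (sym (trans (cong (_∸ 1) (neighbour-level j₀ u≢v)) (m+n∸n≡m _ 1)))) i∈J)
        ... | no v≢y with edge-at (v≢y ∘ sym) ∂J
        ...   | e , e∈J , v∈e with e ≟ i
        ...     | yes refl = not-root (joins-u v∈e)
        ...     | no e≢i = trans (sym (inc-contract-root v≢u v≢r u≢r i))
          (off' (∖-∈ {S = Act} y∈ v≢y) y≢r (drop-join-≢ v≢y ∂J (joins-u v∈e)) (drop-card c e∈J)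
            (trans (cong (J i xor_) (pt-≢ e≢i)) (trans (xor-identityʳ _) i∈J)))

-- The bound `k` drops because each contraction removes one vertex from `Act`. Once adjacency of `v`
-- and `r` is excluded, no neighbour of `v` is the root, so `r` is never merged.
cut-at-root : ∀ {G T Act q r} → Levelled G T Act q r → CutAtRoot G T Act q r
cut-at-root {Act = Act} L = go (card Act) ≤-refl L
  where
  go : ∀ k {G T Act q r} → card Act ≤ k → Levelled G T Act q r → CutAtRoot G T Act q r
  go zero {Act = Act} small L = contradiction (≤-trans (card-∈ {S = Act} (Levelled.root∈ L)) small) λ ()
  go (suc k) {G} {T} {Act} {q} {r} small L with lowest L
  ... | v , v∈ , v≢r , v-min with any? (λ e → (inc G e v ≟ᵇ true) ×-dec (inc G e r ≟ᵇ true))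
  ...   | yes (e , v∈e , r∈e) with inc-other G v∈e
  ...     | z , j , _ = cut-base (subst (Joins G e v) (pt-≡
    (trans (cong (_xor pt z r) (sym (pt-≢ v≢r))) (trans (sym (inc-Joins G j r)) r∈e))) j)
    where open Lowest L v∈ v≢r v-min
  go (suc k) {G} {T} {Act} {q} {r} small L | v , v∈ , v≢r , v-min | no ¬root
    -- The minimum join for the root serves to produce an edge at `v`.
    with Levelled.attained L (Levelled.root∈ L)
  ... | J , ∂J , _ with Lowest.edge-at L v∈ v≢r v-min (v≢r ∘ sym) ∂J
  ...   | e , _ , v∈e with inc-other G v∈e
  ...     | u , j , u≢v with any? (λ e' → (inc G e' v ≟ᵇ true) ×-dec (inc G e' u ≟ᵇ false))
  ...       | yes (e' , v∈e' , u∉e') with inc-other G v∈e'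
  ...         | u' , j' , u'≢v = cut-identify (not-root j v∈e) (not-root j' v∈e') (go k
    (≤-pred (≤-trans (≤-reflexive (trans (+-comm 1 _) (card-∖ {S = Act} a∈))) small))
    (identify (not-root j v∈e) (not-root j' v∈e')))
    where
    open Lowest L v∈ v≢r v-min
    not-root : ∀ {e z} → Joins G e v z → v ∈ inc G e → z ≢ r
    not-root {e} {z} j v∈e refl = ¬root (e , v∈e , trans (inc-Joins G j z) (cong₂ _xor_ (pt-≢ v≢r) (pt-refl z)))
    u≢u' : u ≢ u'
    u≢u' refl = true≢false (trans (inc-Joins G j' u) (cong₂ _xor_ (pt-≢ (u≢v ∘ sym)) (pt-refl u))) u∉e'
    open Pair u≢u' j j' u≢v u'≢v
  go (suc k) {G} {T} {Act} {q} {r} small L | v , v∈ , v≢r , v-min | no ¬root | J , ∂J , _ | e , _ , v∈e | u , j , u≢v | no ¬other =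
    cut-shrink (go k (≤-pred (≤-trans (≤-reflexive (trans (+-comm 1 _) (card-∖ {S = Act} v∈))) small)) shrink)
    where
    open Lowest L v∈ v≢r v-min
    u≢r : u ≢ r
    u≢r refl = ¬root (e , v∈e , trans (inc-Joins G j u) (cong₂ _xor_ (pt-≢ v≢r) (pt-refl u)))
    only : ∀ e → v ∈ inc G e → u ∈ inc G e
    only e v∈e = [ (λ p → p) , (λ p → contradiction (e , v∈e , p) ¬other) ]′ (bool-cases (inc G e u))
    open Pendant j u≢v u≢r only

-- Minimum joins and distances

⨁-∧-△ : (K S : Sub n) (y : Fin n) → ⨁ (λ v → K v ∧ (S △ pt y) v) ≡ ⨁ (λ v → K v ∧ S v) xor K y
⨁-∧-△ K S y = trans (⨁-cong λ v → ∧-distribˡ-xor (K v) (S v) (pt y v))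
  (trans (∑-distrib-+ (λ v → K v ∧ S v) (λ v → K v ∧ pt y v))
    (cong (⨁ (λ v → K v ∧ S v) xor_) (trans (⨁-cong λ v → ∧-comm (K v) (pt y v)) (⨁-pt y K))))

⟦⟧-injective : {a b : Bool} → ⟦ a ⟧ ≡ ⟦ b ⟧ → a ≡ b
⟦⟧-injective {false} {false} _ = refl
⟦⟧-injective {true}  {true}  _ = refl

%2-+ : ∀ {k l} (a b : Bool) → k % 2 ≡ ⟦ a ⟧ → l % 2 ≡ ⟦ b ⟧ → (k + l) % 2 ≡ ⟦ a xor b ⟧
%2-+ {k} {l} a b p q = trans (%-distribˡ-+ k l 2) (trans (cong₂ (λ x y → (x + y) % 2) p q) (small a b))
  where
  small : ∀ a b → (⟦ a ⟧ + ⟦ b ⟧) % 2 ≡ ⟦ a xor b ⟧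
  small false false = refl
  small false true  = refl
  small true  false = refl
  small true  true  = refl

⊖-≥0 : ∀ {a c} → c ≤ a → ℤ.0ℤ ℤ.≤ a ⊖ c
⊖-≥0 {a} {c} h = subst (ℤ._≤ a ⊖ c) (ℤₚ.n⊖n≡0 c) (ℤₚ.⊖-monoˡ-≤ c h)

⊖-≤0 : ∀ {a c} → a ≤ c → a ⊖ c ℤ.≤ ℤ.0ℤ
⊖-≤0 {a} {c} h = subst (a ⊖ c ℤ.≤_) (ℤₚ.n⊖n≡0 c) (ℤₚ.⊖-monoˡ-≤ c h)

⊖-<0 : ∀ {a c} → a < c → a ⊖ c ℤ.< ℤ.0ℤ
⊖-<0 {a} {c} h = subst (a ⊖ c ℤ.<_) (ℤₚ.n⊖n≡0 c) (ℤₚ.⊖-monoˡ-< c h)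

⊖-<0⁻¹ : ∀ {a c} → a ⊖ c ℤ.< ℤ.0ℤ → a < c
⊖-<0⁻¹ h = ≰⇒> λ c≤a → ℤₚ.<⇒≱ h (⊖-≥0 c≤a)

⊖-≥0⁻¹ : ∀ {a c} → ℤ.0ℤ ℤ.≤ a ⊖ c → c ≤ a
⊖-≥0⁻¹ h = ≮⇒≥ λ a<c → ℤₚ.<⇒≱ (⊖-<0 a<c) h

module _ (G : Graph) where

  odd-degree : ∀ F v → Odd (degIn G F v) ⟺ v ∈ ∂ G F
  odd-degree F v = (λ odd → ⟦⟧-injective (trans (sym deg%2) odd)) , (λ h → trans deg%2 (cong ⟦_⟧ h))
    where
    D₁ D₂ : Sub (nE G)
    D₁ e = F e ∧ pt (end₁ G e) v
    D₂ e = F e ∧ pt (end₂ G e) v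
    deg%2 : degIn G F v % 2 ≡ ⟦ ∂ G F v ⟧
    deg%2 = trans (%2-+ {card D₁} {card D₂} (⨁ D₁) (⨁ D₂) (card-%2 D₁) (card-%2 D₂))
      (cong ⟦_⟧ (sym (trans (⨁-cong λ e → ∧-distribˡ-xor (F e) (pt (end₁ G e) v) (pt (end₂ G e) v))
        (∑-distrib-+ D₁ D₂))))

  join-∂ : ∀ {U S F} → IsJoin G U S F → InU G U F × (∀ v → v ∈ U → ∂ G F v ≡ S v)
  join-∂ {F = F} (inU , odd) = inU , λ v v∈U → ⟺→≡
    ((λ h → proj₁ (odd v v∈U) (proj₂ (odd-degree F v) h)) , (λ h → proj₁ (odd-degree F v) (proj₂ (odd v v∈U) h)))

  ∂-join : ∀ {U S F} → InU G U F → (∀ v → v ∈ U → ∂ G F v ≡ S v) → IsJoin G U S F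
  ∂-join {S = S} {F} inU h = inU , λ v v∈U →
    (λ odd → trans (sym (h v v∈U)) (proj₁ (odd-degree F v) odd)) , (λ v∈S → proj₂ (odd-degree F v) (trans (h v v∈U) v∈S))

  -- Every element of the cycle space of G[U] has nonnegative F-weight, the classical criterion for
  -- a minimum join.
  Conservative : Sub (nV G) → Sub (nE G) → Set
  Conservative U F = ∀ Z → InU G U Z → ∂ G Z ≗ ∅ → card F ≤ card (F △ Z)

  InU-△ : ∀ {U J K} → InU G U J → InU G U K → InU G U (J △ K)
  InU-△ {J = J} {K} p q e h with bool-cases (J e)
  ... | inj₁ a = p e a
  ... | inj₂ a = q e (trans (cong (_xor K e) (sym a)) h)

  minJoin-conservative : ∀ {U S F} → IsMinJoin G U S F → Conservative U F
  minJoin-conservative {U} {S} {F} (join , least) Z Z⊆U ∂Z with join-∂ {U} {S} join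
  ... | F⊆U , ∂F = least (F △ Z) (∂-join {U} {S} {F △ Z} (InU-△ {U} {F} {Z} F⊆U Z⊆U) λ v v∈U →
    trans (∂-△ G F Z v) (trans (cong₂ _xor_ (∂F v v∈U) (∂Z v)) (xor-identityʳ (S v))))

  record Shortest (U : Sub (nV G)) (F : Sub (nE G)) (x y : V G) (J₀ : Sub (nE G)) : Set where
    field
      J      : Sub (nE G)
      ∂J     : ∂ G J ≗ pt x △ pt y
      lambda : IsLambda G U F x y (card (F △ J) ⊖ card F)
      short  : card (F △ J) ≤ card (F △ J₀)

  -- An optimal {x , y}-join `K` with x ≠ y contains a path `W` from x to y, and `K △ W` lies in the
  -- cycle space, so dropping it does not raise the weight. Paths are themselves {x , y}-joins,
  -- hence both minima agree.
  shortest : ∀ {U F x y} → Conservative U F → x ∈ U → ∀ {J₀} → InU G U J₀ → ∂ G J₀ ≗ pt x △ pt y →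
    Shortest U F x y J₀
  shortest {U} {F} {x} {y} nonneg x∈U {J₀} J₀⊆U ∂J₀ = build (least resp dec (F △ J₀ , shift J₀ J₀⊆U ∂J₀))
    where
    -- The condition is put on S = F △ K because `least` minimises the size of S itself.
    Good : Sub (nE G) → Set
    Good S = InU G U (F △ S) × ∂ G (F △ S) ≗ pt x △ pt y
    resp : ∀ {S S'} → S ≗ S' → Good S → Good S'
    resp h (i , b) = (λ e p → i e (trans (△-congˡ F h e) p)) , λ v → trans (∂-cong G (△-congˡ F (λ e → sym (h e))) v) (b v)
    dec : ∀ S → Dec (Good S)
    dec S = all? (λ e → ((F △ S) e ≟ᵇ true) →-dec ((U (end₁ G e) ≟ᵇ true) ×-dec (U (end₂ G e) ≟ᵇ true)))
      ×-dec all? (λ v → ∂ G (F △ S) v ≟ᵇ (pt x △ pt y) v)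
    shift : ∀ K → InU G U K → ∂ G K ≗ pt x △ pt y → Good (F △ K)
    shift K i b = (λ e p → i e (trans (sym (△-cancelˡ F K e)) p)) , λ v → trans (∂-cong G (△-cancelˡ F K) v) (b v)
    build : (∃ λ S → Good S × (∀ S' → Good S' → card S ≤ card S')) → Shortest U F x y J₀
    build (S , (S⊆U , ∂S) , S-min) = record
      { J = K ; ∂J = ∂S ; lambda = route , bound
      ; short = subst (_≤ card (F △ J₀)) cardS (S-min (F △ J₀) (shift J₀ J₀⊆U ∂J₀)) }
      where
      K = F △ S
      cardS : card S ≡ card (F △ K)
      cardS = card-cong λ e → sym (△-cancelˡ F S e)
      minimal : ∀ J → InU G U J → ∂ G J ≗ pt x △ pt y → card (F △ K) ≤ card (F △ J)
      minimal J i b = subst (_≤ card (F △ J)) cardS (S-min (F △ J) (shift J i b))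
      bound : ∀ (p : Walk G U (AllE G) x y) → IsPath G p → (card (F △ K) ⊖ card F) ℤ.≤ weight G F p
      bound p isP = subst ((card (F △ K) ⊖ card F) ℤ.≤_) (sym (weight-⊖ G F p isP))
        (ℤₚ.⊖-monoˡ-≤ (card F) (minimal (eset G p) (eset-InU G p) (∂-eset G p)))
      optimal : (p : Walk G U (AllE G) x y) → IsPath G p → card (F △ eset G p) ≤ card (F △ K) →
        Σ (Walk G U (AllE G) x y) λ p → IsPath G p × weight G F p ≡ card (F △ K) ⊖ card F
      optimal p isP le = p , isP , trans (weight-⊖ G F p isP)
        (cong (_⊖ card F) (≤-antisym le (minimal (eset G p) (eset-InU G p) (∂-eset G p))))
      from-path : PathFrom G U K x → Σ (Walk G U (AllE G) x y) λ p → IsPath G p × weight G F p ≡ card (F △ K) ⊖ card F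
      from-path (u' , u'≢x , u'∈∂ , w , isP) with y ≟ u'
      ... | no y≢u' = contradiction (trans (∂S u') (cong₂ _xor_ (pt-≢ (u'≢x ∘ sym)) (pt-≢ y≢u'))) (true≢false u'∈∂)
      ... | yes refl with mapWalk G {Q = AllE G} (λ _ _ → tt) w
      ...   | p , vs , es = optimal p (subst Unique (sym vs) isP) le
        where
        W = eset G w
        rest : card F ≤ card (F △ (K △ W))
        rest = nonneg (K △ W) (InU-△ {U} {K} {W} S⊆U (eset-InU G w)) λ v → trans (∂-△ G K W v)
          (trans (cong₂ _xor_ (∂S v) (∂-eset G w v)) (xor-same ((pt x △ pt y) v)))
        le : card (F △ eset G p) ≤ card (F △ K)
        le = subst (λ z → card (F △ z) ≤ card (F △ K)) (sym es) (+-cancelʳ-≤ (card F) _ _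
          (≤-trans (+-monoʳ-≤ (card (F △ W)) rest)
            (≤-trans (card-△-split F (λ e → eset-∈ G w)) (≤-reflexive (+-comm (card F) _)))))
      route : Σ (Walk G U (AllE G) x y) λ p → IsPath G p × weight G F p ≡ card (F △ K) ⊖ card F
      route with x ≟ y
      ... | no x≢y = from-path (path-from G x S⊆U (trans (∂S x) (cong₂ _xor_ (pt-refl x) (pt-≢ (x≢y ∘ sym)))))
      ... | yes refl = optimal (nil x∈U) ([] ∷ []) (subst (_≤ card (F △ K)) (card-cong λ e → sym (xor-identityʳ (F e)))
        (nonneg K S⊆U λ v → trans (∂S v) (xor-same (pt x v))))

not-true : {b : Bool} → not b ≡ true → b ≡ false
not-true {false} _ = refl

⟦not⟧-≢ : (b : Bool) → ⟦ b ⟧ ≢ ⟦ not b ⟧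
⟦not⟧-≢ false ()
⟦not⟧-≢ true  ()

compl-∉ : {S : Sub n} {x : Fin n} → x ∈ compl S → S x ≡ false
compl-∉ = not-true

∉-compl : {S : Sub n} {x : Fin n} → S x ≡ false → x ∈ compl S
∉-compl h = cong not h

-- Maximal bipartitic extreme sets

module Setting (G : Graph) (T A : Sub (nV G)) (bip : IsBipartition G A) (F : Sub (nE G)) (minF : IsMinJoin G full T F)
  (X : Sub (nV G)) (X⊆A : X ⊆ A) (maxX : MaximalBipExtreme G A F X) where

  ∂F : ∂ G F ≗ T
  ∂F v = proj₂ (join-∂ G {full} {T} {F} (proj₁ minF)) v refl

  in-full : (J : Sub (nE G)) → InU G full J
  in-full J _ _ = refl , refl

  nonneg : ∀ Z → ∂ G Z ≗ ∅ → card F ≤ card (F △ Z)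
  nonneg Z = minJoin-conservative G {full} {T} {F} minF Z (in-full Z)

  shortest-full : ∀ {x y J} → ∂ G J ≗ pt x △ pt y → Shortest G full F x y J
  shortest-full {J = J} = shortest G (λ Z _ → nonneg Z) refl (in-full J)

  lambda-join : ∀ {x y k} → IsLambda G full F x y k → ∃ λ J → ∂ G J ≗ pt x △ pt y × card (F △ J) ⊖ card F ≡ k
  lambda-join ((p , isP , w) , _) = eset G p , ∂-eset G p , trans (sym (weight-⊖ G F p isP)) w

  -- λ(x , y) < 0 for some x in X, without the restriction y ∉ X of InDX.
  Neg : V G → Set
  Neg y = ∃ λ x → x ∈ X × ∃ λ J → ∂ G J ≗ pt x △ pt y × card (F △ J) < card F

  Neg? : ∀ y → Dec (Neg y)
  Neg? y = any? λ x → (X x ≟ᵇ true) ×-dec ∃Sub?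
    (λ { h (b , l) → (λ v → trans (∂-cong G (λ e → sym (h e)) v) (b v)) , subst (_< card F) (card-cong (△-congˡ F h)) l })
    (λ J → all? (λ v → ∂ G J v ≟ᵇ (pt x △ pt y) v) ×-dec (card (F △ J) <? card F))

  InDX→Neg : ∀ {y} → InDX G F X y → Neg y
  InDX→Neg {y} (_ , x , x∈X , k , lam , k<0) with lambda-join lam
  ... | J , ∂J , w = x , x∈X , J , ∂J , ⊖-<0⁻¹ (subst (ℤ._< ℤ.0ℤ) (sym w) k<0)

  Neg→InDX : ∀ {y} → X y ≡ false → Neg y → InDX G F X y
  Neg→InDX {y} y∉X (x , x∈X , J₀ , ∂J₀ , l) = (λ y∈X → true≢false y∈X y∉X) , x , x∈X , _ , lambda , ⊖-<0 (≤-<-trans short l)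
    where open Shortest (shortest-full {x} {y} {J₀} ∂J₀)

  extreme-pair : ∀ {x y Z} → x ∈ X → y ∈ X → ∂ G Z ≗ pt x △ pt y → card F ≤ card (F △ Z)
  extreme-pair {x} {y} {Z} x∈X y∈X ∂Z = ≤-trans (⊖-≥0⁻¹ (proj₂ (proj₁ maxX) x y x∈X y∈X _ lambda)) short
    where open Shortest (shortest-full {x} {y} {Z} ∂Z)

  -- Split off a {u , u'}-join at an odd vertex u: both ends are in `X`, so its weight is
  -- nonnegative, and the smaller remainder still has its boundary in `X`.
  extreme-join : ∀ Z → ∂ G Z ⊆ X → card F ≤ card (F △ Z)
  extreme-join Z h = go Z h (<-wellFounded (card Z))
    where
    go : ∀ Z → ∂ G Z ⊆ X → Acc _<_ (card Z) → card F ≤ card (F △ Z)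
    go Z h (acc rs) = by-cases (any? λ v → ∂ G Z v ≟ᵇ true)
      where
      shrink : ∀ u → u ∈ ∂ G Z → (∃ λ u' → u' ≢ u × u' ∈ ∂ G Z × ∃ λ K → K ⊆ Z × ∂ G K ≗ pt u △ pt u') →
        card F ≤ card (F △ Z)
      shrink u u∈ (u' , u'≢u , u'∈ , K , K⊆Z , ∂K) = +-cancelˡ-≤ (card F) _ _
        (≤-trans (+-mono-≤ (extreme-pair (h u u∈) (h u' u'∈) ∂K) (go (Z △ K) rest⊆X (rs smaller)))
          (card-△-split F K⊆Z))
        where
        rest⊆X : ∂ G (Z △ K) ⊆ X
        rest⊆X v v∈ with u ≟ v | u' ≟ v
        ... | yes refl | _ = h u u∈
        ... | no _ | yes refl = h u' u'∈
        ... | no u≢v | no u'≢v = h v (trans (sym (trans (∂-△ G Z K v)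
          (trans (cong (∂ G Z v xor_) (trans (∂K v) (cong₂ _xor_ (pt-≢ u≢v) (pt-≢ u'≢v)))) (xor-identityʳ _)))) v∈)
        smaller : card (Z △ K) < card Z
        smaller with ∂-edge G (trans (∂K u) (cong₂ _xor_ (pt-refl u) (pt-≢ u'≢u)))
        ... | e , e∈K , _ = ≤-trans (≤-reflexive (+-comm 1 _))
          (≤-trans (+-monoˡ-≤ 1 (card-mono {S = Z △ K} {Z △ pt e} sub)) (≤-reflexive (card-△-pt-∈ Z (K⊆Z e e∈K))))
          where
          sub : (Z △ K) ⊆ (Z △ pt e)
          sub i i∈ with e ≟ i
          ... | yes refl = contradiction (trans (sym i∈) (cong₂ _xor_ (K⊆Z e e∈K) e∈K)) λ ()
          ... | no _ with bool-cases (Z i) | bool-cases (K i)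
          ...   | inj₁ p | _ = trans (xor-identityʳ _) p
          ...   | inj₂ p | inj₁ q = contradiction (K⊆Z i q) λ r → true≢false r p
          ...   | inj₂ p | inj₂ q = contradiction (trans (sym i∈) (cong₂ _xor_ p q)) λ ()
      by-cases : Dec (∃ λ v → ∂ G Z v ≡ true) → card F ≤ card (F △ Z)
      by-cases (yes (u , u∈)) = shrink u u∈ (split-off G {full} u (in-full Z) u∈)
      by-cases (no none) = nonneg Z λ v → [ (λ p → contradiction (v , p) none) , (λ p → p) ]′ (bool-cases (∂ G Z v))

  -- Otherwise `X` together with `a` would be a larger extreme set inside `A`.
  Neg-A : ∀ {a} → a ∈ A → X a ≡ false → Neg a
  Neg-A {a} a∈A a∉X with Neg? a
  ... | yes p = p
  ... | no ¬neg = contradiction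
    ((λ x x∈X → cong (_∨ pt a x) x∈X) , a , trans (cong (_∨ pt a a) a∉X) (pt-refl a) , λ a∈X → true≢false a∈X a∉X)
    (proj₂ maxX Y (inj₁ Y⊆A , Y-extreme))
    where
    Y : Sub (nV G)
    Y v = X v ∨ pt a v
    Y-cases : ∀ {v} → v ∈ Y → v ∈ X ⊎ a ≡ v
    Y-cases {v} v∈Y with X v
    ... | true  = inj₁ refl
    ... | false = inj₂ (pt-≡ v∈Y)
    Y⊆A : Y ⊆ A
    Y⊆A v v∈Y = [ X⊆A v , (λ { refl → a∈A }) ]′ (Y-cases v∈Y)
    far : ∀ {x J} → x ∈ X → ∂ G J ≗ pt x △ pt a → card F ≤ card (F △ J)
    far {x} {J} x∈X ∂J = ≮⇒≥ λ l → ¬neg (x , x∈X , J , ∂J , l)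
    Y-extreme : Extreme G F Y
    Y-extreme x y x∈Y y∈Y k lam with lambda-join lam
    ... | J , ∂J , w = subst (ℤ.0ℤ ℤ.≤_) w (⊖-≥0 (bound (Y-cases x∈Y) (Y-cases y∈Y)))
      where
      bound : x ∈ X ⊎ a ≡ x → y ∈ X ⊎ a ≡ y → card F ≤ card (F △ J)
      bound (inj₁ p)    (inj₁ s)    = extreme-pair p s ∂J
      bound (inj₁ p)    (inj₂ refl) = far p ∂J
      bound (inj₂ refl) (inj₁ s)    = far s λ v → trans (∂J v) (xor-comm (pt a v) (pt y v))
      bound (inj₂ refl) (inj₂ refl) = nonneg J λ v → trans (∂J v) (xor-same (pt a v))


  -- Every edge crosses `A`, so |J| has the parity of the number of odd vertices of `J` in `A`.
  ⨁-same-side : ∀ {x y J} → x ∈ A → y ∈ A → ∂ G J ≗ pt x △ pt y → ⨁ J ≡ false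
  ⨁-same-side {x} {y} {J} x∈A y∈A ∂J = begin
    ⨁ J                             ≡⟨ ⨁-cong (λ e → trans (sym (∧-identityʳ (J e))) (cong (J e ∧_) (sym (bip e)))) ⟩
    ⨁ (λ e → J e ∧ crosses G A e)   ≡⟨ ⨁-∂ G A J ⟨
    ⨁ (λ v → A v ∧ ∂ G J v)         ≡⟨ ⨁-cong (λ v → cong (A v ∧_) (∂J v)) ⟩
    ⨁ (λ v → A v ∧ (pt x △ pt y) v) ≡⟨ ⨁-∧-△ A (pt x) y ⟩
    ⨁ (λ v → A v ∧ pt x v) xor A y  ≡⟨ cong (_xor A y) (trans (⨁-cong λ v → ∧-comm (A v) (pt x v)) (⨁-pt x A)) ⟩
    A x xor A y                     ≡⟨ cong₂ _xor_ x∈A y∈A ⟩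
    false                           ∎
    where open ≡-Reasoning

  -- Joins between two vertices of one colour class have even weight, so a negative one has weight at most −2.
  Neg-step : ∀ {e a b} → Joins G e a b → a ∈ A → Neg a → Neg b
  Neg-step {e} {a} {b} j a∈A (x , x∈X , J , ∂J , l) = x , x∈X , J △ pt e ,
    (λ v → trans (∂-△-pt G J e v) (trans (cong₂ _xor_ (∂J v) (inc-Joins G j v))
      (solve 3 (λ x a b → (x :+ a) :+ (a :+ b) := x :+ b) refl (pt x v) (pt a v) (pt b v)))) ,
    (begin-strict
      card (F △ (J △ pt e))   ≡⟨ card-cong (λ i → xor-assoc (F i) (J i) (pt e i)) ⟨
      card ((F △ J) △ pt e)   ≤⟨ card-△-pt-≤ (F △ J) e ⟩
      card (F △ J) + 1        ≡⟨ +-comm _ 1 ⟩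
      suc (card (F △ J))      <⟨ ≤∧≢⇒< l odd-gap ⟩
      card F                  ∎)
    where
    open ≤-Reasoning
    same-parity : card (F △ J) % 2 ≡ ⟦ ⨁ F ⟧
    same-parity = trans (card-%2 (F △ J)) (cong ⟦_⟧ (trans (∑-distrib-+ F J)
      (trans (cong (⨁ F xor_) (⨁-same-side (X⊆A x x∈X) a∈A ∂J)) (xor-identityʳ (⨁ F)))))
    odd-gap : suc (card (F △ J)) ≢ card F
    odd-gap h = ⟦not⟧-≢ (⨁ F) (trans (sym (card-%2 F)) (trans (cong (_% 2) (sym h)) (%2-suc (card (F △ J)) (⨁ F) same-parity)))

  Joins-other-side : ∀ {e b z} → Joins G e b z → A b ≡ false → z ∈ A
  Joins-other-side {e} (inj₁ (refl , refl)) h = trans (cong (_xor A (end₂ G e)) (sym h)) (bip e)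
  Joins-other-side {e} (inj₂ (refl , refl)) h = trans (sym (xor-identityʳ _)) (trans (cong (A (end₁ G e) xor_) (sym h)) (bip e))

  -- In `A`, the vertex `b` would be negative by maximality. So `z` is in `A`, and outside `X` it
  -- would be negative and pass this on to `b`.
  neighbours-in-X : ∀ {e b z} → X b ≡ false → ¬ Neg b → Joins G e b z → z ∈ X
  neighbours-in-X {e} {b} {z} b∉X ¬neg j with bool-cases (A b) | bool-cases (X z)
  ... | inj₁ b∈A | _        = contradiction (Neg-A b∈A b∉X) ¬neg
  ... | inj₂ _   | inj₁ z∈X = z∈X
  ... | inj₂ b∉A | inj₂ z∉X = contradiction (Neg-step (Joins-sym G j) z∈A (Neg-A z∈A z∉X)) ¬neg
    where z∈A = Joins-other-side j b∉A

  -- An F-edge from `X` to `b` has weight -1 and would make `b` negative.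
  no-F-edge : ∀ {e b} → X b ≡ false → ¬ Neg b → b ∈ inc G e → F e ≡ false
  no-F-edge {e} {b} b∉X ¬neg b∈e with bool-cases (F e) | inc-other G b∈e
  ... | inj₂ p | _ = p
  ... | inj₁ e∈F | z , j , _ = contradiction
    (z , neighbours-in-X b∉X ¬neg j , pt e , (λ v → trans (∂-pt G e v) (inc-Joins G (Joins-sym G j) v)) ,
      ≤-reflexive (trans (+-comm 1 _) (card-△-pt-∈ F e∈F))) ¬neg

  -- A vertex outside `X` that is not negative has all its neighbours in `X`, so a walk avoiding `X`
  -- cannot step onto it.
  Neg-walk : ∀ {x y} → Walk G (compl X) (AllE G) x y → Neg x → Neg y
  Neg-walk (nil _) neg = neg
  Neg-walk (cons {x} {z} e _ j x∈ w) neg with Neg? z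
  ... | yes negz = Neg-walk w negz
  ... | no ¬neg = contradiction (neighbours-in-X (compl-∉ {S = X} (start∈ G w)) ¬neg (Joins-sym G j)) λ x∈X → true≢false x∈X (compl-∉ {S = X} x∈)

  -- The double count `⨁-∂` with ∂F = T. It turns the counts 1 and 0 of F-edges leaving a component
  -- into odd and even.
  card-∩-parity : ∀ C → card (T ∩ C) % 2 ≡ card (λ e → F e ∧ crosses G C e) % 2
  card-∩-parity C = trans (card-%2 (T ∩ C)) (trans (cong ⟦_⟧
    (trans (⨁-cong λ v → trans (∧-comm (T v) (C v)) (cong (C v ∧_) (sym (∂F v)))) (⨁-∂ G C F)))
    (sym (card-%2 λ e → F e ∧ crosses G C e)))

  -- Vertices outside X ∪ D_X

  module Isolated {C : Sub (nV G)} {b} (b∉X : X b ≡ false) (¬neg : ¬ Neg b)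
    (C-walk : ∀ y → (y ∈ C ⟺ Walk G (compl X) (AllE G) b y)) where

    C-pt : C ≗ pt b
    C-pt y = ⟺→≡ ((λ y∈C → only (proj₁ (C-walk y) y∈C)) , λ h → proj₂ (C-walk y) (subst (Walk G (compl X) (AllE G) b) (pt-≡ h) (nil (∉-compl {S = X} b∉X))))
      where
      only : Walk G (compl X) (AllE G) b y → y ∈ pt b
      only (nil _) = pt-refl b
      only (cons e _ j _ w) = contradiction (neighbours-in-X b∉X ¬neg j) λ z∈X → true≢false z∈X (compl-∉ {S = X} (start∈ G w))

    crosses-inc : ∀ e → crosses G C e ≡ inc G e b
    crosses-inc e = cong₂ _xor_ (trans (C-pt _) (pt-sym b _)) (trans (C-pt _) (pt-sym b _))

    uncrossed : card (λ e → F e ∧ crosses G C e) ≡ 0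
    uncrossed = trans (card-cong none) (card-∅ {nE G})
      where
      none : ∀ e → F e ∧ crosses G C e ≡ false
      none e with bool-cases (crosses G C e)
      ... | inj₂ p = trans (cong (F e ∧_) p) (∧-zeroʳ (F e))
      ... | inj₁ p = cong (_∧ crosses G C e) (no-F-edge b∉X ¬neg (trans (sym (crosses-inc e)) p))

    not-allowed : ∀ {e z} → Joins G e b z → ¬ Allowed G T e
    not-allowed {e} {z} j (F' , minF' , e∈F') = contradiction
      (z , z∈X , J , ∂J , ≤-trans (≤-reflexive (trans (+-comm 1 _) small)) (proj₂ minF' F (proj₁ minF))) ¬neg
      where
      z∈X = neighbours-in-X b∉X ¬neg j
      -- F △ F' lies in the cycle space, so `J` joins `z` to `b`; and F △ J = F' △ {e} is one edge
      -- short of the minimum.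
      J = (F △ F') △ pt e
      ∂J : ∂ G J ≗ pt z △ pt b
      ∂J v = trans (∂-△-pt G (F △ F') e v) (trans (cong₂ _xor_
        (trans (∂-△ G F F' v) (trans (cong₂ _xor_ (∂F v) (proj₂ (join-∂ G {full} {T} {F'} (proj₁ minF')) v refl)) (xor-same (T v))))
        (inc-Joins G j v)) (xor-comm (pt b v) (pt z v)))
      small : card (F △ J) + 1 ≡ card F'
      small = trans (cong (_+ 1) (card-cong λ i →
        solve 3 (λ f g e → f :+ ((f :+ g) :+ e) := g :+ e) refl (F i) (F' i) (pt e i))) (card-△-pt-∈ F' e∈F')

    factor-component : IsFactorComponent G T C
    factor-component = b , refl , λ y →
      (λ y∈C → subst (Walk G full (Allowed G T) b) (pt-≡ (trans (sym (C-pt y)) y∈C)) (nil refl)) ,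
      (λ w → trans (C-pt y) (only w))
      where
      only : ∀ {y} → Walk G full (Allowed G T) b y → y ∈ pt b
      only (nil _) = pt-refl b
      only (cons e a j _ w) = contradiction a (not-allowed j)

    single : card C ≡ 1
    single = trans (card-cong C-pt) (card-pt b)

  -- Components of G[D_X] and their contraction

  module Component {C : Sub (nV G)} {c} (c∈C : c ∈ C) (C-out : ∀ {y} → y ∈ C → X y ≡ false)
    (closed : ∀ {e y z} → Joins G e y z → y ∈ C → X z ≡ false → z ∈ C)
    (linked : ∀ (K : Sub (nV G)) → (∀ e → end₁ G e ∈ C → end₂ G e ∈ C → K (end₁ G e) ≡ K (end₂ G e)) →
      ∀ {y} → y ∈ C → K y ≡ K c)
    (C-neg : ∀ {y} → y ∈ C → Neg y) where

    -- Taking a vertex of `X` to stand for everything outside `C` gives the contracted vertex the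
    -- colour of the outer ends of all edges leaving `C`.
    r₀ : V G
    r₀ = proj₁ (C-neg c∈C)

    r₀∈X : r₀ ∈ X
    r₀∈X = proj₁ (proj₂ (C-neg c∈C))

    X-out : ∀ {x} → x ∈ X → C x ≡ false
    X-out {x} x∈X with bool-cases (C x)
    ... | inj₂ p = p
    ... | inj₁ p = contradiction (C-out p) (true≢false x∈X)

    C-≢ : ∀ {x y} → y ∈ C → C x ≡ false → x ≢ y
    C-≢ y∈C x∉C refl = true≢false y∈C x∉C

    ρ : V G → V G
    ρ v = if C v then v else r₀

    G₁ : Graph
    G₁ = record { nV = nV G ; nE = nE G ; end₁ = ρ ∘ end₁ G ; end₂ = ρ ∘ end₂ G }

    ρ-∈ : ∀ {v} → v ∈ C → ρ v ≡ v
    ρ-∈ {v} h = cong (if_then v else r₀) h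

    ρ-∉ : ∀ {v} → C v ≡ false → ρ v ≡ r₀
    ρ-∉ {v} h = cong (if_then v else r₀) h

    pt-ρ-∈ : ∀ {v} x → v ∈ C → pt (ρ x) v ≡ pt x v
    pt-ρ-∈ {v} x v∈C with bool-cases (C x)
    ... | inj₁ x∈C = cong (λ z → pt z v) (ρ-∈ x∈C)
    ... | inj₂ x∉C = trans (cong (λ z → pt z v) (ρ-∉ x∉C))
      (trans (pt-≢ (C-≢ v∈C (X-out r₀∈X))) (sym (pt-≢ (C-≢ v∈C x∉C))))

    pt-ρ-root : ∀ x → pt (ρ x) r₀ ≡ not (C x)
    pt-ρ-root x with bool-cases (C x)
    ... | inj₁ x∈C = trans (cong (λ z → pt z r₀) (ρ-∈ x∈C))
      (trans (pt-≢ (C-≢ x∈C (X-out r₀∈X) ∘ sym)) (cong not (sym x∈C)))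
    ... | inj₂ x∉C = trans (cong (λ z → pt z r₀) (ρ-∉ x∉C)) (trans (pt-refl r₀) (cong not (sym x∉C)))

    pt-ρ-∉ : ∀ {v} x → C v ≡ false → r₀ ≢ v → pt (ρ x) v ≡ false
    pt-ρ-∉ {v} x v∉C r₀≢v with bool-cases (C x)
    ... | inj₁ x∈C = trans (cong (λ z → pt z v) (ρ-∈ x∈C)) (pt-≢ (C-≢ x∈C v∉C ∘ sym))
    ... | inj₂ x∉C = trans (cong (λ z → pt z v) (ρ-∉ x∉C)) (pt-≢ r₀≢v)

    ∂₁-∈ : ∀ J {v} → v ∈ C → ∂ G₁ J v ≡ ∂ G J v
    ∂₁-∈ J v∈C = ⨁-cong λ e → cong (J e ∧_) (cong₂ _xor_ (pt-ρ-∈ (end₁ G e) v∈C) (pt-ρ-∈ (end₂ G e) v∈C))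

    ∂₁-∉ : ∀ J {v} → C v ≡ false → r₀ ≢ v → ∂ G₁ J v ≡ false
    ∂₁-∉ J v∉C r₀≢v = ∂-isolated G₁ {J} λ e _ → cong₂ _xor_ (pt-ρ-∉ (end₁ G e) v∉C r₀≢v) (pt-ρ-∉ (end₂ G e) v∉C r₀≢v)

    ∂₁-partner : ∀ J {u} → u ∈ ∂ G₁ J → ∃ λ u' → u' ≢ u × u' ∈ ∂ G₁ J
    ∂₁-partner J {u} h with split-off G₁ {full} u (λ _ _ → refl , refl) h
    ... | u' , u'≢u , u'∈ , _ = u' , u'≢u , u'∈

    -- The root cannot be the only odd vertex of G₁.
    ∂₁-zero : ∀ J → (∀ {v} → v ∈ C → ∂ G J v ≡ false) → ∂ G₁ J ≗ ∅
    ∂₁-zero J h v with bool-cases (C v) | r₀ ≟ v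
    ... | inj₁ v∈C | _ = trans (∂₁-∈ J v∈C) (h v∈C)
    ... | inj₂ v∉C | no r₀≢v = ∂₁-∉ J v∉C r₀≢v
    ... | inj₂ _ | yes refl with bool-cases (∂ G₁ J r₀)
    ...   | inj₂ p = p
    ...   | inj₁ p with ∂₁-partner J p
    ...     | u' , u'≢r₀ , u'∈ = contradiction u'∈ (off (bool-cases (C u')))
      where
      off : u' ∈ C ⊎ C u' ≡ false → ¬ (u' ∈ ∂ G₁ J)
      off (inj₁ u'∈C) q = true≢false q (trans (∂₁-∈ J u'∈C) (h u'∈C))
      off (inj₂ u'∉C) q = true≢false q (∂₁-∉ J u'∉C (u'≢r₀ ∘ sym))

    ∂₁-pair : ∀ J {y} → y ∈ C → (∀ {v} → v ∈ C → ∂ G J v ≡ pt y v) → ∂ G₁ J ≗ pt r₀ △ pt y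
    ∂₁-pair J {y} y∈C h v with bool-cases (C v) | r₀ ≟ v
    ... | inj₁ v∈C | yes refl = contradiction (X-out r₀∈X) (true≢false v∈C)
    ... | inj₁ v∈C | no _ = trans (∂₁-∈ J v∈C) (h v∈C)
    ... | inj₂ v∉C | no r₀≢v = trans (∂₁-∉ J v∉C r₀≢v) (sym (pt-≢ (C-≢ y∈C v∉C ∘ sym)))
    ... | inj₂ v∉C | yes refl = trans root (cong (true xor_) (sym (pt-≢ (C-≢ y∈C v∉C ∘ sym))))
      where
      root : ∂ G₁ J r₀ ≡ true
      root with ∂₁-partner J (trans (∂₁-∈ J y∈C) (trans (h y∈C) (pt-refl y)))
      ... | u' , u'≢y , u'∈ with bool-cases (C u') | r₀ ≟ u'
      ...   | inj₁ u'∈C | _ = contradiction (trans (∂₁-∈ J u'∈C) (trans (h u'∈C) (pt-≢ (u'≢y ∘ sym)))) (true≢false u'∈)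
      ...   | inj₂ u'∉C | no r₀≢u' = contradiction (∂₁-∉ J u'∉C r₀≢u') (true≢false u'∈)
      ...   | inj₂ _ | yes refl = u'∈

    touch : Sub (nE G)
    touch e = C (end₁ G e) ∨ C (end₂ G e)

    Joins-touch : ∀ {e y z} → Joins G e y z → y ∈ C → e ∈ touch
    Joins-touch {e} (inj₁ (refl , refl)) y∈C = cong (_∨ C (end₂ G e)) y∈C
    Joins-touch {e} (inj₂ (refl , refl)) y∈C = trans (cong (C (end₁ G e) ∨_) y∈C) (∨-zeroʳ _)

    inc-touch : ∀ {e v} → v ∈ C → v ∈ inc G e → e ∈ touch
    inc-touch v∈C v∈e with inc-other G v∈e
    ... | _ , j , _ = Joins-touch j v∈C

    touch-other : ∀ {e v} → e ∈ touch → v ∈ inc G e → C v ≡ false → X v ≡ true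
    touch-other {e} {v} t v∈e v∉C with inc-other G v∈e | bool-cases (X v)
    ... | _ | inj₁ v∈X = v∈X
    ... | z , j , _ | inj₂ v∉X = contradiction v∉C (true≢false (closed (Joins-sym G j) (z∈C j) v∉X))
      where
      z∈C : ∀ {z} → Joins G e v z → z ∈ C
      z∈C (inj₁ (refl , refl)) = trans (cong (_∨ C (end₂ G e)) (sym v∉C)) t
      z∈C (inj₂ (refl , refl)) = trans (sym (∨-identityʳ _)) (trans (cong (C (end₁ G e) ∨_) (sym v∉C)) t)

    ∂-∩-touch : ∀ J {v} → v ∈ C → ∂ G (J ∩ touch) v ≡ ∂ G J v
    ∂-∩-touch J {v} v∈C = ∂-agree G v λ e v∈e → trans (cong (J e ∧_) (inc-touch v∈C v∈e)) (∧-identityʳ (J e))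

    ∂-∖-touch-∈ : ∀ J {v} → v ∈ C → ∂ G (J ∖ touch) v ≡ false
    ∂-∖-touch-∈ J {v} v∈C = trans (∂-agree G {J ∖ touch} {∅} v λ e v∈e →
      trans (cong (λ t → J e ∧ not t) (inc-touch v∈C v∈e)) (∧-zeroʳ (J e))) (∂-∅ G v)

    ∂-∖-touch-∉ : ∀ J {v} → C v ≡ false → X v ≡ false → ∂ G (J ∖ touch) v ≡ ∂ G J v
    ∂-∖-touch-∉ J {v} v∉C v∉X = ∂-agree G v λ e v∈e → trans (cong (λ t → J e ∧ not t) (untouched e v∈e)) (∧-identityʳ (J e))
      where
      untouched : ∀ e → v ∈ inc G e → touch e ≡ false
      untouched e v∈e with bool-cases (touch e)
      ... | inj₂ p = p
      ... | inj₁ p = contradiction v∉X (true≢false (touch-other p v∈e v∉C))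

    FC : Sub (nE G)
    FC = F ∩ touch

    -- Exchange the part of F at `C` for that of `J`. The boundary of the exchange `Z` vanishes on
    -- `C` and otherwise consists of outer ends of edges leaving `C`, which belong to `X`; so
    -- `extreme-join` forbids a gain.
    card-bound : ∀ {J} → (∀ {v} → v ∈ C → ∂ G J v ≡ T v) → card FC ≤ card J
    card-bound {J} h = ≤-trans (+-cancelʳ-≤ (card (F ∖ touch)) _ _ (begin
      card FC + card (F ∖ touch)                        ≡⟨ card-split F touch ⟨
      card F                                            ≤⟨ extreme-join Z Z⊆X ⟩
      card (F △ Z)                                      ≡⟨ card-split (F △ Z) touch ⟩
      card ((F △ Z) ∩ touch) + card ((F △ Z) ∖ touch)
        ≡⟨ cong₂ _+_ (card-cong λ e → inside (F e) (J e) (touch e)) (card-cong λ e → outside (F e) (J e) (touch e)) ⟩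
      card (J ∩ touch) + card (F ∖ touch)               ∎)) (card-mono {S = J ∩ touch} {J} λ e p → proj₁ (∧-true p))
      where
      open ≤-Reasoning
      Z = (J ∩ touch) △ FC
      inside : ∀ f j t → (f xor ((j ∧ t) xor (f ∧ t))) ∧ t ≡ j ∧ t
      inside f j true  = solve 2 (λ f j → (f :+ (j :* con true :+ f :* con true)) :* con true := j :* con true) refl f j
      inside f j false = trans (∧-zeroʳ _) (sym (∧-zeroʳ j))
      outside : ∀ f j t → (f xor ((j ∧ t) xor (f ∧ t))) ∧ not t ≡ f ∧ not t
      outside f j true  = trans (∧-zeroʳ _) (sym (∧-zeroʳ f))
      outside f j false = solve 2 (λ f j → (f :+ (j :* con false :+ f :* con false)) :* con true := f :* con true) refl f j
      Z-touch : ∀ {e} → e ∈ Z → e ∈ touch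
      Z-touch {e} e∈Z with touch e
      ... | true  = refl
      ... | false = contradiction (trans (sym e∈Z) (cong₂ _xor_ (∧-zeroʳ (J e)) (∧-zeroʳ (F e)))) λ ()
      Z⊆X : ∂ G Z ⊆ X
      Z⊆X v v∈ with bool-cases (C v)
      ... | inj₁ v∈C = contradiction (trans (∂-△ G (J ∩ touch) FC v) (trans (cong₂ _xor_
        (trans (∂-∩-touch J v∈C) (h v∈C)) (trans (∂-∩-touch F v∈C) (∂F v))) (xor-same (T v)))) (true≢false v∈)
      ... | inj₂ v∉C with ∂-edge G v∈
      ...   | e , e∈Z , v∈e = touch-other (Z-touch e∈Z) v∈e v∉C

    -- Cut the negative join `Z` along `touch`. The part away from `C` has its boundary in `X` and
    -- so nonnegative weight; hence the part at `C` is already negative.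
    negative-join : ∀ {y} → y ∈ C → ∃ λ J → (∀ {v} → v ∈ C → ∂ G J v ≡ T v xor pt y v) × card J < card FC
    negative-join {y} y∈C with C-neg y∈C
    ... | x , x∈X , Z , ∂Z , l = (F △ Z) ∩ touch , ∂J , smaller
      where
      ∂J : ∀ {v} → v ∈ C → ∂ G ((F △ Z) ∩ touch) v ≡ T v xor pt y v
      ∂J {v} v∈C = trans (∂-∩-touch (F △ Z) v∈C) (trans (∂-△ G F Z v) (cong₂ _xor_ (∂F v)
        (trans (∂Z v) (cong (_xor pt y v) (pt-≢ (C-≢ v∈C (X-out x∈X)))))))
      rest⊆X : ∂ G (Z ∖ touch) ⊆ X
      rest⊆X v v∈ with bool-cases (C v) | bool-cases (X v)
      ... | inj₁ v∈C | _ = contradiction (∂-∖-touch-∈ Z v∈C) (true≢false v∈)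
      ... | inj₂ _   | inj₁ v∈X = v∈X
      ... | inj₂ v∉C | inj₂ v∉X = contradiction (trans (∂-∖-touch-∉ Z v∉C v∉X) (trans (∂Z v)
        (cong₂ _xor_ (pt-≢ {a = x} {v} λ { refl → true≢false x∈X v∉X }) (pt-≢ (C-≢ y∈C v∉C ∘ sym))))) (true≢false v∈)
      smaller : card ((F △ Z) ∩ touch) < card FC
      smaller = +-cancelʳ-< (card ((F △ Z) ∖ touch)) _ _ (begin-strict
        card ((F △ Z) ∩ touch) + card ((F △ Z) ∖ touch)   ≡⟨ card-split (F △ Z) touch ⟨
        card (F △ Z)                                      <⟨ l ⟩
        card F                                            ≤⟨ extreme-join (Z ∖ touch) rest⊆X ⟩
        card (F △ (Z ∖ touch))                            ≡⟨ card-split (F △ (Z ∖ touch)) touch ⟩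
        card ((F △ (Z ∖ touch)) ∩ touch) + card ((F △ (Z ∖ touch)) ∖ touch)
          ≡⟨ cong₂ _+_ (card-cong λ e → inside (F e) (Z e) (touch e)) (card-cong λ e → outside (F e) (Z e) (touch e)) ⟩
        card FC + card ((F △ Z) ∖ touch)                  ∎)
        where
        open ≤-Reasoning
        inside : ∀ f z t → (f xor (z ∧ not t)) ∧ t ≡ f ∧ t
        inside f z true  = solve 2 (λ f z → (f :+ z :* con false) :* con true := f :* con true) refl f z
        inside f z false = trans (∧-zeroʳ _) (sym (∧-zeroʳ f))
        outside : ∀ f z t → (f xor (z ∧ not t)) ∧ not t ≡ (f xor z) ∧ not t
        outside f z true  = trans (∧-zeroʳ _) (sym (∧-zeroʳ (f xor z)))
        outside f z false = solve 2 (λ f z → (f :+ z :* con true) :* con true := (f :+ z) :* con true) refl f z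

    -- Toggled at `r₀` so that `FC` is a join for `r₀`; on `C` the set `T₁` agrees with T.
    T₁ Act : Sub (nV G)
    T₁ = ∂ G₁ FC △ pt r₀
    Act v = C v ∨ pt r₀ v

    Act-cases : ∀ {v} → v ∈ Act → v ∈ C ⊎ r₀ ≡ v
    Act-cases {v} h with C v
    ... | true  = inj₁ refl
    ... | false = inj₂ (pt-≡ h)

    C⊆Act : ∀ {v} → v ∈ C → v ∈ Act
    C⊆Act {v} v∈C = cong (_∨ pt r₀ v) v∈C

    r₀∈Act : r₀ ∈ Act
    r₀∈Act = trans (cong (C r₀ ∨_) (pt-refl r₀)) (∨-zeroʳ _)

    Act-≢ : ∀ {v} → v ∈ Act → v ≢ r₀ → v ∈ C
    Act-≢ v∈ v≢r₀ = [ (λ p → p) , (λ p → contradiction (sym p) v≢r₀) ]′ (Act-cases v∈)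

    ρ-Act : ∀ v → ρ v ∈ Act
    ρ-Act v with bool-cases (C v)
    ... | inj₁ v∈C = subst (_∈ Act) (sym (ρ-∈ v∈C)) (C⊆Act v∈C)
    ... | inj₂ v∉C = subst (_∈ Act) (sym (ρ-∉ v∉C)) r₀∈Act

    ∂-FC : ∀ {v} → v ∈ C → ∂ G FC v ≡ T v
    ∂-FC {v} v∈C = trans (∂-∩-touch F v∈C) (∂F v)

    lift-root : ∀ {J} → (∀ {v} → v ∈ C → ∂ G J v ≡ T v) → ∂ G₁ J ≗ T₁ △ pt r₀
    lift-root {J} h v = trans (xor-≡ (trans (sym (∂-△ G₁ J FC v)) (∂₁-zero (J △ FC) (λ {v} v∈C →
      trans (∂-△ G J FC v) (trans (cong₂ _xor_ (h v∈C) (∂-FC v∈C)) (xor-same (T v)))) v)))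
      (sym (△-cancelʳ (∂ G₁ FC) (pt r₀) v))

    lift-C : ∀ {J y} → y ∈ C → (∀ {v} → v ∈ C → ∂ G J v ≡ T v xor pt y v) → ∂ G₁ J ≗ T₁ △ pt y
    lift-C {J} {y} y∈C h v = begin
      ∂ G₁ J v                                  ≡⟨ △-cancelʳ (∂ G₁ J) (∂ G₁ FC) v ⟨
      (∂ G₁ J v xor ∂ G₁ FC v) xor ∂ G₁ FC v    ≡⟨ cong (_xor ∂ G₁ FC v) (trans (sym (∂-△ G₁ J FC v)) (∂₁-pair (J △ FC) y∈C pair v)) ⟩
      (pt r₀ v xor pt y v) xor ∂ G₁ FC v        ≡⟨ solve 3 (λ r y f → (r :+ y) :+ f := (f :+ r) :+ y) refl (pt r₀ v) (pt y v) (∂ G₁ FC v) ⟩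
      (T₁ △ pt y) v                             ∎
      where
      open ≡-Reasoning
      pair : ∀ {v} → v ∈ C → ∂ G (J △ FC) v ≡ pt y v
      pair {v} v∈C = trans (∂-△ G J FC v) (trans (cong₂ _xor_ (h v∈C) (∂-FC v∈C))
        (solve 2 (λ t y → (t :+ y) :+ t := y) refl (T v) (pt y v)))

    lower-∂ : ∀ {J y v} → v ∈ C → ∂ G₁ J ≗ T₁ △ pt y → ∂ G J v ≡ T v xor pt y v
    lower-∂ {J} {y} {v} v∈C h = trans (sym (∂₁-∈ J v∈C)) (trans (h v)
      (cong (_xor pt y v) (trans (cong₂ _xor_ (trans (∂₁-∈ FC v∈C) (∂-FC v∈C)) (pt-≢ (C-≢ v∈C (X-out r₀∈X)))) (xor-identityʳ (T v)))))

    lower-root : ∀ {J v} → v ∈ C → ∂ G₁ J ≗ T₁ △ pt r₀ → ∂ G J v ≡ T v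
    lower-root v∈C h = trans (lower-∂ v∈C h) (trans (cong (T _ xor_) (pt-≢ (C-≢ v∈C (X-out r₀∈X)))) (xor-identityʳ _))

    JoinAt : V G → Sub (nE G) → Set
    JoinAt y J = ∂ G₁ J ≗ T₁ △ pt y

    Best : V G → Set
    Best y = ∃ λ J → JoinAt y J × (∀ J' → JoinAt y J' → card J ≤ card J')

    abstract
      best : ∀ y → y ∈ Act → Best y
      best y y∈ = least (λ h b v → trans (∂-cong G₁ (λ e → sym (h e)) v) (b v))
        (λ J → all? (λ v → ∂ G₁ J v ≟ᵇ (T₁ △ pt y) v)) (start (Act-cases y∈))
        where
        start : y ∈ C ⊎ r₀ ≡ y → ∃ (JoinAt y)
        start (inj₁ y∈C) with negative-join y∈C
        ... | J , ∂J , _ = J , lift-C y∈C ∂J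
        start (inj₂ refl) = FC , lift-root ∂-FC

      -- Membership in `Act` is assumed inside the property, so that q depends on `y` alone; its
      -- value outside `Act` is 0.
      q-exists : ∀ y → ∃ λ k → y ∈ Act → (∃ λ J → JoinAt y J × card J ≡ k) × (∀ {J} → JoinAt y J → k ≤ card J)
      q-exists y with bool-cases (Act y)
      ... | inj₂ y∉ = 0 , λ y∈ → contradiction y∉ (true≢false y∈)
      ... | inj₁ y∈ with best y y∈
      ...   | J , ∂J , J-min = card J , λ _ → (J , ∂J , refl) , J-min _

    q : V G → ℕ
    q y = proj₁ (q-exists y)

    q-attained : ∀ {y} → y ∈ Act → ∃ λ J → JoinAt y J × card J ≡ q y
    q-attained {y} y∈ = proj₁ (proj₂ (q-exists y) y∈)

    q-lower : ∀ {y J} → y ∈ Act → JoinAt y J → q y ≤ card J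
    q-lower {y} y∈ = proj₂ (proj₂ (q-exists y) y∈)

    q-root : card FC ≡ q r₀
    q-root with q-attained r₀∈Act
    ... | J , ∂J , c = ≤-antisym (≤-trans (card-bound λ v∈C → lower-root v∈C ∂J) (≤-reflexive c))
      (q-lower r₀∈Act (lift-root ∂-FC))

    q-below : ∀ {y} → y ∈ C → q y < q r₀
    q-below y∈C with negative-join y∈C
    ... | J , ∂J , l = ≤-<-trans (q-lower (C⊆Act y∈C) (lift-C y∈C ∂J)) (subst (card J <_) q-root l)

    -- An edge leaving `C` has its outer end in `X`, on the side of `r₀`, so moving that end to `r₀`
    -- respects the colours. Edges away from `C` become loops at `r₀`.
    touch-cases : ∀ e → (touch e ≡ false × ρ (end₁ G e) ≡ r₀ × ρ (end₂ G e) ≡ r₀) ⊎ crosses G₁ A e ≡ true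
    touch-cases e with bool-cases (C (end₁ G e)) | bool-cases (C (end₂ G e))
    ... | inj₂ s∉C | inj₂ t∉C = inj₁ (cong₂ _∨_ s∉C t∉C , ρ-∉ s∉C , ρ-∉ t∉C)
    ... | inj₁ s∈C | inj₁ t∈C = inj₂ (trans (cong₂ (λ x y → A x xor A y) (ρ-∈ s∈C) (ρ-∈ t∈C)) (bip e))
    ... | inj₁ s∈C | inj₂ t∉C = inj₂ (trans (cong₂ (λ x y → A x xor A y) (ρ-∈ s∈C) (ρ-∉ t∉C))
      (trans (cong (A (end₁ G e) xor_) (trans (X⊆A r₀ r₀∈X) (sym (X⊆A _ t∈X)))) (bip e)))
      where
      t∈X : end₂ G e ∈ X
      t∈X = [ (λ p → p) , (λ p → contradiction t∉C (true≢false (closed (inj₁ (refl , refl)) s∈C p))) ]′ (bool-cases (X (end₂ G e)))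
    ... | inj₂ s∉C | inj₁ t∈C = inj₂ (trans (cong₂ (λ x y → A x xor A y) (ρ-∉ s∉C) (ρ-∈ t∈C))
      (trans (cong (_xor A (end₂ G e)) (trans (X⊆A r₀ r₀∈X) (sym (X⊆A _ s∈X)))) (bip e)))
      where
      s∈X : end₁ G e ∈ X
      s∈X = [ (λ p → p) , (λ p → contradiction s∉C (true≢false (closed (inj₂ (refl , refl)) t∈C p))) ]′ (bool-cases (X (end₁ G e)))

    touch-crosses : ∀ {e} → e ∈ touch → crosses G₁ A e ≡ true
    touch-crosses {e} t = [ (λ { (p , _) → contradiction p (true≢false t) }) , (λ p → p) ]′ (touch-cases e)

    nonloop-crosses : ∀ {e} → end₁ G₁ e ≢ end₂ G₁ e → crosses G₁ A e ≡ true
    nonloop-crosses {e} s≢t = [ (λ { (_ , p , p') → contradiction (trans p (sym p')) s≢t }) , (λ p → p) ]′ (touch-cases e)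

    ∂₁-∩-touch : ∀ J v → ∂ G₁ (J ∩ touch) v ≡ ∂ G₁ J v
    ∂₁-∩-touch J v = ∂-agree G₁ v λ e v∈e → trans (cong (J e ∧_) (touched e v∈e (touch-cases e))) (∧-identityʳ (J e))
      where
      touched : ∀ e → v ∈ inc G₁ e → (touch e ≡ false × ρ (end₁ G e) ≡ r₀ × ρ (end₂ G e) ≡ r₀) ⊎ crosses G₁ A e ≡ true → touch e ≡ true
      touched e v∈e (inj₁ (_ , p , p')) = contradiction (trans (cong₂ (λ x y → pt x v xor pt y v) p p') (xor-same (pt r₀ v))) (true≢false v∈e)
      touched e v∈e (inj₂ p) with bool-cases (C (end₁ G e)) | bool-cases (C (end₂ G e))
      ... | inj₁ s∈C | _        = cong (_∨ C (end₂ G e)) s∈C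
      ... | inj₂ _   | inj₁ t∈C = trans (cong (C (end₁ G e) ∨_) t∈C) (∨-zeroʳ _)
      ... | inj₂ s∉C | inj₂ t∉C = contradiction (trans (cong₂ (λ x y → A x xor A y) (ρ-∉ s∉C) (ρ-∉ t∉C)) (xor-same (A r₀))) (true≢false p)

    -- Without the loops at `r₀` all edges of a minimum join cross `A`, so its size has the parity
    -- of its odd vertices in `A`, which depends on `y` only through its colour.
    q-parity : ∀ {y} → y ∈ Act → q y % 2 ≡ ⟦ ⨁ (λ v → A v ∧ T₁ v) xor A y ⟧
    q-parity {y} y∈ with q-attained y∈
    ... | J , ∂J , c = trans (cong (_% 2) (sym card-K)) (trans (card-%2 K) (cong ⟦_⟧ (begin
      ⨁ K                              ≡⟨ ⨁-cong crossing ⟩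
      ⨁ (λ e → K e ∧ crosses G₁ A e)   ≡⟨ ⨁-∂ G₁ A K ⟨
      ⨁ (λ v → A v ∧ ∂ G₁ K v)         ≡⟨ ⨁-cong (λ v → cong (A v ∧_) (∂K v)) ⟩
      ⨁ (λ v → A v ∧ (T₁ △ pt y) v)    ≡⟨ ⨁-∧-△ A T₁ y ⟩
      ⨁ (λ v → A v ∧ T₁ v) xor A y     ∎)))
      where
      open ≡-Reasoning
      K = J ∩ touch
      ∂K : JoinAt y K
      ∂K v = trans (∂₁-∩-touch J v) (∂J v)
      card-K : card K ≡ q y
      card-K = ≤-antisym (≤-trans (card-mono {S = K} {J} λ e p → proj₁ (∧-true p)) (≤-reflexive c)) (q-lower y∈ ∂K)
      crossing : ∀ e → K e ≡ K e ∧ crosses G₁ A e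
      crossing e with bool-cases (K e)
      ... | inj₂ p = trans p (cong (_∧ crosses G₁ A e) (sym p))
      ... | inj₁ p = trans p (sym (∧-intro p (touch-crosses (proj₂ (∧-true p)))))

    q-step : ∀ e → end₁ G₁ e ≢ end₂ G₁ e → q (end₁ G₁ e) ≢ q (end₂ G₁ e)
    q-step e s≢t h = contradiction (xor-cancel (⨁ (λ v → A v ∧ T₁ v)) (A (end₁ G₁ e)) (A (end₂ G₁ e)) (⟦⟧-injective (trans (sym (q-parity (ρ-Act (end₁ G e))))
      (trans (cong (_% 2) h) (q-parity (ρ-Act (end₂ G e))))))) (same-≢ (A (end₁ G₁ e)) (A (end₂ G₁ e)) (nonloop-crosses s≢t))
      where
      xor-cancel : ∀ b x y → b xor x ≡ b xor y → x ≡ y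
      xor-cancel false _ _ p = p
      xor-cancel true  _ _ p = not-injective p
      same-≢ : ∀ x y → x xor y ≡ true → x ≢ y
      same-≢ x _ p refl = true≢false p (xor-same x)

    contraction : Levelled G₁ T₁ Act q r₀
    contraction = record
      { ends∈    = λ e → ρ-Act (end₁ G e) , ρ-Act (end₂ G e)
      ; root∈    = r₀∈Act
      ; other    = c , C⊆Act c∈C , C-≢ c∈C (X-out r₀∈X) ∘ sym
      ; attained = q-attained
      ; lower    = q-lower
      ; below    = λ y∈ y≢r₀ → q-below (Act-≢ y∈ y≢r₀)
      ; step     = q-step
      ; conn     = conn₁
      }
      where
      conn₁ : ∀ (K : Sub (nV G)) → (∀ e → end₁ G₁ e ≢ r₀ → end₂ G₁ e ≢ r₀ → K (end₁ G₁ e) ≡ K (end₂ G₁ e)) →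
        ∀ {x y} → x ∈ Act → y ∈ Act → x ≢ r₀ → y ≢ r₀ → K x ≡ K y
      conn₁ K h x∈ y∈ x≢r₀ y≢r₀ = trans (link (Act-≢ x∈ x≢r₀)) (sym (link (Act-≢ y∈ y≢r₀)))
        where
        ρ-≢ : ∀ {v} → v ∈ C → ρ v ≢ r₀
        ρ-≢ v∈C p = C-≢ v∈C (X-out r₀∈X) (sym (trans (sym (ρ-∈ v∈C)) p))
        link : ∀ {y} → y ∈ C → K y ≡ K c
        link = linked K λ e s∈C t∈C → trans (cong K (sym (ρ-∈ s∈C))) (trans (h e (ρ-≢ s∈C) (ρ-≢ t∈C)) (cong K (ρ-∈ t∈C)))

    inc₁-root : ∀ e → inc G₁ e r₀ ≡ crosses G C e
    inc₁-root e = trans (cong₂ _xor_ (pt-ρ-root (end₁ G e)) (pt-ρ-root (end₂ G e))) (xor-annihilates-not (C (end₁ G e)) _)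

    crossed-once : card (λ e → F e ∧ crosses G C e) ≡ 1
    crossed-once = trans (card-cong eq) (proj₁ (cut-at-root contraction) (lift-root ∂-FC) q-root)
      where
      absorb : ∀ f s t → f ∧ (s xor t) ≡ (f ∧ (s ∨ t)) ∧ (s xor t)
      absorb false _     _     = refl
      absorb true  false false = refl
      absorb true  false true  = refl
      absorb true  true  _     = refl
      eq : ∀ e → F e ∧ crosses G C e ≡ FC e ∧ inc G₁ e r₀
      eq e = trans (absorb (F e) (C (end₁ G e)) (C (end₂ G e))) (cong (FC e ∧_) (sym (inc₁-root e)))

    -- By the second half of `cut-at-root` a minimum join for `y` does not cross the boundary of
    -- `C`; its edges outside `C` are loops at `r₀` and are thrown away.
    inner-join : ∀ {y} → y ∈ C → ∃ λ N → InU G C N × (∀ {v} → v ∈ C → ∂ G N v ≡ T v xor pt y v) × card N < card FC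
    inner-join {y} y∈C with q-attained (C⊆Act y∈C)
    ... | J , ∂J , card-J = N , (λ e p → ∧-true (proj₂ (∧-true {J e} p))) ,
      (λ {v} v∈C → trans (∂-agree G v (inside v∈C)) (lower-∂ v∈C ∂J)) ,
      ≤-<-trans (card-mono {S = N} {J} λ e p → proj₁ (∧-true p))
        (subst₂ _<_ (sym card-J) (sym q-root) (q-below y∈C))
      where
      N : Sub (nE G)
      N e = J e ∧ (C (end₁ G e) ∧ C (end₂ G e))
      both : ∀ s t → s ∨ t ≡ true → s xor t ≡ false → s ∧ t ≡ true
      both true  true  _  _  = refl
      both true  false _  ()
      both false true  _  ()
      both false false () _
      uncrossed : ∀ {e} → e ∈ J → crosses G C e ≡ false
      uncrossed {e} e∈J = trans (sym (inc₁-root e))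
        (proj₂ (cut-at-root contraction) (C⊆Act y∈C) (C-≢ y∈C (X-out r₀∈X) ∘ sym) ∂J card-J e∈J)
      inside : ∀ {v} → v ∈ C → ∀ e → v ∈ inc G e → N e ≡ J e
      inside v∈C e v∈e with bool-cases (J e)
      ... | inj₂ p = trans (cong (_∧ _) p) (sym p)
      ... | inj₁ p = trans (cong (J e ∧_) (both (C (end₁ G e)) (C (end₂ G e)) (inc-touch v∈C v∈e) (uncrossed p))) (∧-identityʳ (J e))

    -- Primality at the end of the crossing edge

    module Rooted {e r} (crossing : crosses G C e ≡ true) (r∈C : r ∈ C) (r-end : end₁ G e ≡ r ⊎ end₂ G e ≡ r) where

      S : Sub (nV G)
      S = symdiffPt G T C r

      S-∈ : ∀ {v} → v ∈ C → S v ≡ T v xor pt r v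
      S-∈ {v} v∈C = trans (cong (_∧ (T v xor pt v r)) v∈C) (cong (T v xor_) (pt-sym v r))

      ∂-e : ∀ {v} → v ∈ C → inc G e v ≡ pt r v
      ∂-e {v} v∈C = [ at₁ , at₂ ]′ r-end
        where
        at₁ : end₁ G e ≡ r → inc G e v ≡ pt r v
        at₁ refl = trans (cong (pt r v xor_) (pt-≢ (C-≢ v∈C (not-true (trans (cong (_xor C (end₂ G e)) (sym r∈C)) crossing))))) (xor-identityʳ _)
        at₂ : end₂ G e ≡ r → inc G e v ≡ pt r v
        at₂ refl = cong (_xor pt r v) (pt-≢ (C-≢ v∈C (not-true
          (trans (xor-comm true _) (trans (cong (C (end₁ G e) xor_) (sym r∈C)) crossing)))))

      ∂-inside : ∀ {J v} → InU G C J → C v ≡ false → ∂ G J v ≡ false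
      ∂-inside {J} {v} J⊆C v∉C = ∂-isolated G {J} λ i i∈J → cong₂ _xor_
        (pt-≢ (C-≢ (proj₁ (J⊆C i i∈J)) v∉C ∘ sym)) (pt-≢ (C-≢ (proj₂ (J⊆C i i∈J)) v∉C ∘ sym))

      module _ {F'} (minF' : IsMinJoin G C S F') where

        F'⊆C : InU G C F'
        F'⊆C = proj₁ (join-∂ G {C} {S} {F'} (proj₁ minF'))

        ∂F' : ∀ {v} → v ∈ C → ∂ G F' v ≡ T v xor pt r v
        ∂F' {v} v∈C = trans (proj₂ (join-∂ G {C} {S} {F'} (proj₁ minF')) v v∈C) (S-∈ v∈C)

        -- Seen from `C`, the crossing edge `e` has boundary {r}; toggling it gives a set that
        -- competes with `FC`.
        one-more : ∀ {K} → (∀ {v} → v ∈ C → ∂ G K v ≡ T v xor pt r v) → card FC ≤ card K + 1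
        one-more {K} h = ≤-trans (card-bound {K △ pt e} λ {v} v∈C → trans (∂-△-pt G K e v)
          (trans (cong₂ _xor_ (h v∈C) (∂-e v∈C)) (△-cancelʳ T (pt r) v))) (card-△-pt-≤ K e)

        InnerJoin : V G → Set
        InnerJoin y = ∃ λ N → InU G C N × (∀ {v} → v ∈ C → ∂ G N v ≡ T v xor pt y v) × card N < card FC

        -- With `one-more` this gives |FC| = |F'| + 1, so F' has the size of `FC` without its
        -- crossing edge.
        F'-small : card F' < card FC
        F'-small = compare (inner-join r∈C)
          where
          compare : InnerJoin r → card F' < card FC
          compare (N , N⊆C , ∂N , l) = ≤-<-trans (proj₂ minF' N N-join) l
            where
            N-join : IsJoin G C S N
            N-join = ∂-join G {C} {S} {N} N⊆C λ v v∈C → trans (∂N v∈C) (sym (S-∈ v∈C))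

        Distance : V G → Set
        Distance y = ∃ λ J → ∂ G J ≗ pt r △ pt y ×
          IsLambda G C F' r y (card (F' △ J) ⊖ card F') × card (F' △ J) ≤ card F'

        -- For `J₀` = F' △ N the set F' △ J₀ is `N`, and |N| < |FC| ≤ |F'| + 1.
        distance : ∀ {y} → y ∈ C → Distance y
        distance {y} y∈C = build (inner-join y∈C)
          where
          build : InnerJoin y → Distance y
          build (N , N⊆C , ∂N , l) = Shortest.J sh , Shortest.∂J sh , Shortest.lambda sh , ≤-trans (Shortest.short sh) small
            where
            J₀ = F' △ N
            ∂J₀ : ∂ G J₀ ≗ pt r △ pt y
            ∂J₀ v = trans (∂-△ G F' N v) ([ on-C , off-C ]′ (bool-cases (C v)))
              where
              on-C : v ∈ C → ∂ G F' v xor ∂ G N v ≡ pt r v xor pt y v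
              on-C v∈C = trans (cong₂ _xor_ (∂F' v∈C) (∂N v∈C))
                (solve 3 (λ t r y → (t :+ r) :+ (t :+ y) := r :+ y) refl (T v) (pt r v) (pt y v))
              off-C : C v ≡ false → ∂ G F' v xor ∂ G N v ≡ pt r v xor pt y v
              off-C v∉C = trans (cong₂ _xor_ (∂-inside {F'} F'⊆C v∉C) (∂-inside {N} N⊆C v∉C))
                (sym (cong₂ _xor_ (pt-≢ (C-≢ r∈C v∉C ∘ sym)) (pt-≢ (C-≢ y∈C v∉C ∘ sym))))
            small : card (F' △ J₀) ≤ card F'
            small = ≤-trans (≤-reflexive (card-cong (△-cancelˡ F' N)))
              (≤-pred (≤-trans l (≤-trans (one-more {F'} ∂F') (≤-reflexive (+-comm _ 1)))))
            sh : Shortest G C F' r y J₀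
            sh = shortest G (minJoin-conservative G {C} {S} {F'} minF') r∈C {J₀} (InU-△ G {C} {F'} {N} F'⊆C N⊆C) ∂J₀

        -- If `J` had negative weight, F' △ J with the edge `i` toggled would have at most |F'|
        -- edges and match T on `C`, where at least |FC| edges are required.
        neighbour-far : ∀ {i u y J} → Joins G i u y → u ∈ X → y ∈ C → ∂ G J ≗ pt r △ pt y → card F' ≤ card (F' △ J)
        neighbour-far {i} {u} {y} {J} j u∈X y∈C ∂J = ≤-pred (≤-trans F'-small (≤-trans (card-bound {K} ∂K)
          (≤-trans (card-△-pt-≤ (F' △ J) i) (≤-reflexive (+-comm _ 1)))))
          where
          K = (F' △ J) △ pt i
          ∂K : ∀ {v} → v ∈ C → ∂ G K v ≡ T v
          ∂K {v} v∈C = trans (∂-△-pt G (F' △ J) i v) (trans (cong₂ _xor_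
            (trans (∂-△ G F' J v) (cong₂ _xor_ (∂F' v∈C) (∂J v)))
            (trans (inc-Joins G j v) (cong (_xor pt y v) (pt-≢ (C-≢ v∈C (X-out u∈X))))))
            (solve 3 (λ t r y → ((t :+ r) :+ (r :+ y)) :+ y := t) refl (T v) (pt r v) (pt y v)))

      primal : Primal G C S r
      primal F' minF' y y∈C = bound (distance minF' y∈C)
        where
        bound : Distance minF' y → ∃ λ k → IsLambda G C F' r y k × k ℤ.≤ ℤ.0ℤ
        bound (J , _ , lam , le) = _ , lam , ⊖-≤0 le

      neighbour-InA : ∀ y → InN G X y → y ∈ C → InA G C S r y
      neighbour-InA y (_ , i , u , j , u∈X) y∈C = y∈C , λ F' minF' → zero-distance F' minF' (distance minF' y∈C)
        where
        zero-distance : ∀ F' (minF' : IsMinJoin G C S F') → Distance minF' y → IsLambda G C F' r y ℤ.0ℤ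
        zero-distance F' minF' (J , ∂J , lam , le) = subst (IsLambda G C F' r y)
          (trans (cong (_⊖ card F') (≤-antisym le (neighbour-far minF' j u∈X y∈C ∂J))) (ℤₚ.n⊖n≡0 (card F'))) lam

  -- Components of G - X

  module IsComp {C : Sub (nV G)} {b} (b∈ : b ∈ compl X) (C-walk : ∀ y → (y ∈ C ⟺ Walk G (compl X) (AllE G) b y)) where

    b∉X : X b ≡ false
    b∉X = compl-∉ {S = X} b∈

    private
      end∈ : ∀ {x y} → Walk G (compl X) (AllE G) x y → y ∈ compl X
      end∈ (nil p)          = p
      end∈ (cons _ _ _ _ w) = end∈ w

      snoc : ∀ {e x y z} → Walk G (compl X) (AllE G) x y → Joins G e y z → z ∈ compl X → Walk G (compl X) (AllE G) x z
      snoc (nil p)          j z∈ = cons _ tt j p (nil z∈)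
      snoc (cons e a k p w) j z∈ = cons e a k p (snoc w j z∈)

      closed : ∀ {e y z} → Joins G e y z → y ∈ C → X z ≡ false → z ∈ C
      closed {z = z} j y∈C z∉X = proj₂ (C-walk z) (snoc (proj₁ (C-walk _) y∈C) j (∉-compl {S = X} z∉X))

      b∈C : b ∈ C
      b∈C = proj₂ (C-walk b) (nil b∈)

      Joins-≡ : ∀ {e x z} (K : Sub (nV G)) → Joins G e x z → K (end₁ G e) ≡ K (end₂ G e) → K z ≡ K x
      Joins-≡ K (inj₁ (refl , refl)) h = sym h
      Joins-≡ K (inj₂ (refl , refl)) h = h

      -- Connectivity is phrased by labellings constant along edges, a form that passes through
      -- contractions by composing with `redirect`.
      linked : ∀ (K : Sub (nV G)) → (∀ e → end₁ G e ∈ C → end₂ G e ∈ C → K (end₁ G e) ≡ K (end₂ G e)) →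
        ∀ {y} → y ∈ C → K y ≡ K b
      linked K h {y} y∈C = along (proj₁ (C-walk y) y∈C) b∈C
        where
        along : ∀ {x y} → Walk G (compl X) (AllE G) x y → x ∈ C → K y ≡ K x
        along (nil _) _ = refl
        along (cons {z = z} e _ j _ w) x∈C = trans (along w z∈C) (Joins-≡ K j (h e (proj₁ ends) (proj₂ ends)))
          where
          z∈C : z ∈ C
          z∈C = closed j x∈C (compl-∉ {S = X} (start∈ G w))
          ends : InE G C e
          ends = Joins-InE G j x∈C z∈C

    module Attached (neg : Neg b) = Component {C} {b} b∈C
      (λ {y} y∈C → compl-∉ {S = X} (end∈ (proj₁ (C-walk y) y∈C))) closed linked
      (λ {y} y∈C → Neg-walk (proj₁ (C-walk y) y∈C) neg)

    module Detached (¬neg : ¬ Neg b) = Isolated {C} {b} b∉X ¬neg C-walk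

    -- F leaves a negative component once and any other never, so the parity of T ∩ C decides,
    -- conversely, whether `b` is negative.
    Neg⇒odd : Neg b → Odd (card (T ∩ C))
    Neg⇒odd neg = trans (card-∩-parity C) (cong (_% 2) (Attached.crossed-once neg))

    ¬Neg⇒even : ¬ Neg b → Even (card (T ∩ C))
    ¬Neg⇒even ¬neg = trans (card-∩-parity C) (cong (_% 2) (Detached.uncrossed ¬neg))

    odd⇒Neg : Odd (card (T ∩ C)) → Neg b
    odd⇒Neg odd with Neg? b
    ... | yes neg = neg
    ... | no ¬neg = contradiction (trans (sym (¬Neg⇒even ¬neg)) odd) λ ()

    even⇒¬Neg : Even (card (T ∩ C)) → ¬ Neg b
    even⇒¬Neg even neg = contradiction (trans (sym (Neg⇒odd neg)) even) λ ()

  combic : FCombic G T F X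
  combic = (λ e _ (s∈X , t∈X) → contradiction (bip e) λ p → true≢false p (cong₂ _xor_ (X⊆A _ s∈X) (X⊆A _ t∈X))) ,
    (λ { C ((b , b∈ , w) , odd) → IsComp.Attached.crossed-once b∈ w (IsComp.odd⇒Neg b∈ w odd) }) ,
    (λ { C ((b , b∈ , w) , even) → IsComp.Detached.uncrossed b∈ w (IsComp.even⇒¬Neg b∈ w even) })

  components-of-D : ∀ (D : Sub (nV G)) → (∀ y → (y ∈ D ⟺ InDX G F X y)) →
    ∀ C → (IsComponent G D C ⟺ IsOddComp G T (compl X) C)
  components-of-D D D-spec C = to , from
    where
    D→Neg : ∀ {y} → y ∈ D → Neg y
    D→Neg {y} y∈D = InDX→Neg (proj₁ (D-spec y) y∈D)
    D→∉X : ∀ {y} → y ∈ D → y ∈ compl X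
    D→∉X {y} y∈D = [ (λ y∈X → contradiction y∈X (proj₁ (proj₁ (D-spec y) y∈D))) , ∉-compl {S = X} ]′ (bool-cases (X y))
    Neg→D : ∀ {y} → y ∈ compl X → Neg y → y ∈ D
    Neg→D {y} y∈ neg = proj₂ (D-spec y) (Neg→InDX (compl-∉ {S = X} y∈) neg)
    widen : ∀ {x y} → Walk G D (AllE G) x y → Walk G (compl X) (AllE G) x y
    widen (nil p)          = nil (D→∉X p)
    widen (cons e a j p w) = cons e a j (D→∉X p) (widen w)
    -- Negativity spreads along the walk, so the walk never leaves `D`.
    narrow : ∀ {x y} → Neg x → Walk G (compl X) (AllE G) x y → Walk G D (AllE G) x y
    narrow neg (nil p) = nil (Neg→D p neg)
    narrow neg (cons e a j p w) = cons e a j (Neg→D p neg)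
      (narrow (Neg-walk (cons e a j p (nil (start∈ G w))) neg) w)
    to : IsComponent G D C → IsOddComp G T (compl X) C
    to (b , b∈D , w) = (b , D→∉X b∈D , w') , IsComp.Neg⇒odd (D→∉X b∈D) w' (D→Neg b∈D)
      where
      w' : ∀ y → (y ∈ C ⟺ Walk G (compl X) (AllE G) b y)
      w' y = (λ y∈C → widen (proj₁ (w y) y∈C)) , (λ p → proj₂ (w y) (narrow (D→Neg b∈D) p))
    from : IsOddComp G T (compl X) C → IsComponent G D C
    from ((b , b∈ , w) , odd) = b , Neg→D b∈ neg ,
      λ y → (λ y∈C → narrow neg (proj₁ (w y) y∈C)) , (λ p → proj₂ (w y) (widen p))
      where
      neg : Neg b
      neg = IsComp.odd⇒Neg b∈ w odd

theorem7p4 : (G : Graph) (T A : Sub (nV G)) → IsBipartition G A →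
    (F : Sub (nE G)) → IsMinJoin G full T F →
    (X : Sub (nV G)) → X ⊆ A → MaximalBipExtreme G A F X →
    FCombic G T F X
    × (∀ (D : Sub (nV G)) → (∀ y → (y ∈ D ⟺ InDX G F X y)) →
    ∀ C → (IsComponent G D C ⟺ IsOddComp G T (compl X) C))
    × (∀ C → IsOddComp G T (compl X) C →
    ∀ e r → e ∈ F → crosses G C e ≡ true → r ∈ C →
    (end₁ G e ≡ r ⊎ end₂ G e ≡ r) →
    Primal G C (symdiffPt G T C r) r
    × (∀ v → InN G X v → v ∈ C → InA G C (symdiffPt G T C r) r v))
    × (∀ C → IsEvenComp G T (compl X) C →
    IsFactorComponent G T C × card C ≡ 1)
theorem7p4 G T A bip F minF X X⊆A maxX = combic , components-of-D , odd , even
  where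
  open Setting G T A bip F minF X X⊆A maxX
  odd : ∀ C → IsOddComp G T (compl X) C →
    ∀ e r → e ∈ F → crosses G C e ≡ true → r ∈ C → (end₁ G e ≡ r ⊎ end₂ G e ≡ r) →
    Primal G C (symdiffPt G T C r) r × (∀ v → InN G X v → v ∈ C → InA G C (symdiffPt G T C r) r v)
  odd C ((b , b∈ , w) , odd-C) e r _ crossing r∈C r-end = primal , neighbour-InA
    where
    open IsComp b∈ w
    open Attached (odd⇒Neg odd-C)
    open Rooted crossing r∈C r-end
  even : ∀ C → IsEvenComp G T (compl X) C → IsFactorComponent G T C × card C ≡ 1
  even C ((b , b∈ , w) , even-C) = factor-component , single
    where
    open IsComp b∈ w
    open Detached (even⇒¬Neg even-C)
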